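{- The varieties $\mathsf{C3DP}$ (c3dp-algebras), $\mathsf{B3SM}$ (bounded three-valued Sugihara monoids), $\mathsf{C3\text{Ł}}$ (centred three-valued Łukasiewicz algebras) and $\mathsf{C3MV}$ (centred three-valued MV-algebras) are (pairwise) term equivalent.
   Context: Term equivalence: two varieties $V$ and $W$ are term equivalent if each basic operation of $W$ can be defined by a term in the signature of $V$ and each basic operation of $V$ by a term in the signature of $W$, so that these definitions turn every algebra of $V$ into an algebra of $W$ on the same universe and vice versa, and the two passages are mutually inverse. $\mathsf{C3DP}$: a dp-algebra is an algebra $(A;\wedge,\vee,\neg,D,0,1)$ such that $(A;\wedge,\vee,0,1)$ is a bounded distributive lattice; $\neg a$ is the greatest $b\in A$ with $a\wedge b=0$; and $Da$ is the smallest $b\in A$ with $a\vee b=1$. It is regular if $a\wedge Da\le b\vee\neg b$ for all $a,b$. A c3dp-algebra is an algebra $(A;\wedge,\vee,\neg,D,0,c,1)$ such that $(A;\wedge,\vee,\neg,D,0,1)$ is a regular dp-algebra satisfying $\neg x\vee\neg\neg x=1$ and $Dx\wedge DDx=0$, and $\neg c=0$, $Dc=1$. $\mathsf{B3SM}$: an odd Sugihara monoid is an algebra $(A;\wedge,\vee,\cdot,\sim,e)$ of type $(2,2,2,1,0)$ such that $(A;\vee,\wedge)$ is a distributive lattice; $(A;\cdot,e)$ is a commutative monoid with $x\le x\cdot x$; $\sim\sim x=x$; if $z\cdot x\le y$ then $z\cdot\sim y\le\ \sim x$; and $\sim e=e$. A bounded odd Sugihara monoid is an algebra $(A;\wedge,\vee,\cdot,\sim,0,e,1)$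 such that $(A;\vee,\wedge,0,1)$ is a bounded lattice and $(A;\wedge,\vee,\cdot,\sim,e)$ is an odd Sugihara monoid. It is three-valued if it satisfies $e\le x\vee\sim(x\cdot 1)$. $\mathsf{C3\text{Ł}}$: a three-valued Łukasiewicz algebra is an algebra $(A;\wedge,\vee,\sim,\nabla,0,1)$ such that $(A;\wedge,\vee,0,1)$ is a bounded distributive lattice and for all $a,b$: $\sim\sim a=a$, $\sim(a\wedge b)=\ \sim a\vee\sim b$, $\sim a\vee\nabla a=1$, $a\wedge\sim a=\ \sim a\wedge\nabla a$, $\nabla(a\wedge b)=\nabla a\wedge\nabla b$. A centred one is an algebra $(A;\wedge,\vee,\sim,\nabla,0,z,1)$ whose reduct without $z$ is a three-valued Łukasiewicz algebra and whose constant $z$ satisfies $\sim z=z$. $\mathsf{C3MV}$: a centred three-valued MV-algebra is an algebra $(A;\oplus,\sim,0,c)$ of type $(2,1,0,0)$ such that $(A;\oplus,0)$ is a commutative monoid and for all $a,b$: $\sim\sim a=a$, $a\oplus\sim 0=\ \sim 0$, $\sim(\sim a\oplus b)\oplus b=\ \sim(\sim b\oplus a)\oplus a$, $a\oplus(a\oplus a)=a\oplus a$, and $\sim c=c$. -}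

module Defs where

open import Level using (Level; _⊔_; suc)
open import Algebra.Core using (Op₁; Op₂)
open import Data.Fin.Base using (Fin)
open import Data.Nat.Base using (ℕ)
open import Data.Product.Base using (_×_)
open import Data.Vec.Base using (Vec; []; _∷_; lookup)
open import Data.Vec.Relation.Binary.Pointwise.Inductive as Pointwise
  using (Pointwise; []; _∷_)
open import Relation.Binary.Bundles using (Setoid)
open import Relation.Binary.Definitions using (Minimum; Maximum)
open import Relation.Binary.Construct.NaturalOrder.Left as NaturalOrder using ()
import Algebra.Lattice.Structures as LatticeStructures
import Algebra.Structures as AlgebraStructures

private
  variable
    a ℓ : Level

record Signature : Set₁ where
  field
    Op    : Set
    arity : Op → ℕ

open Signature public

data Term (S : Signature) (n : ℕ) : Set where
  var : Fin n → Term S n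
  app : (f : Op S) → Vec (Term S n) (arity S f) → Term S n

-- The universe is an index rather than a field, so that "on the same
-- universe" can be expressed by typing.  Equality of elements is the
-- equality of the setoid.

record Algebra (S : Signature) (X : Setoid a ℓ) : Set (a ⊔ ℓ) where
  open Setoid X
  field
    interp : (f : Op S) → Vec Carrier (arity S f) → Carrier
    cong   : (f : Op S) {xs ys : Vec Carrier (arity S f)} →
             Pointwise _≈_ xs ys → interp f xs ≈ interp f ys

open Algebra public

module _ {S : Signature} {X : Setoid a ℓ} (𝐀 : Algebra S X) where
  open Setoid X

  mutual
    eval : {n : ℕ} → Term S n → Vec Carrier n → Carrier
    eval (var i)    ρ = lookup ρ i
    eval (app f ts) ρ = interp 𝐀 f (evals ts ρ)

    evals : {n m : ℕ} → Vec (Term S n) m → Vec Carrier n → Vec Carrier m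
    evals []       ρ = []
    evals (t ∷ ts) ρ = eval t ρ ∷ evals ts ρ

  mutual
    eval-cong : {n : ℕ} (t : Term S n) {ρ σ : Vec Carrier n} →
                Pointwise _≈_ ρ σ → eval t ρ ≈ eval t σ
    eval-cong (var i)    ρ≈σ = Pointwise.lookup ρ≈σ i
    eval-cong (app f ts) ρ≈σ = cong 𝐀 f (evals-cong ts ρ≈σ)

    evals-cong : {n m : ℕ} (ts : Vec (Term S n) m) {ρ σ : Vec Carrier n} →
                 Pointwise _≈_ ρ σ → Pointwise _≈_ (evals ts ρ) (evals ts σ)
    evals-cong []       ρ≈σ = []
    evals-cong (t ∷ ts) ρ≈σ = eval-cong t ρ≈σ ∷ evals-cong ts ρ≈σ

-- A definition of every basic operation of S, of arity n, by a term of
-- T in n variables.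

Translation : Signature → Signature → Set
Translation S T = (f : Op S) → Term T (arity S f)

derived : {S T : Signature} {X : Setoid a ℓ} →
          Translation S T → Algebra T X → Algebra S X
derived σ 𝐀 = record
  { interp = λ f → eval 𝐀 (σ f)
  ; cong   = λ f → eval-cong 𝐀 (σ f)
  }

infix 4 _≐_

_≐_ : {S : Signature} {X : Setoid a ℓ} → Algebra S X → Algebra S X → Set (a ⊔ ℓ)
_≐_ {S = S} {X = X} 𝐀 𝐁 =
  (f : Op S) (xs : Vec Carrier (arity S f)) → interp 𝐀 f xs ≈ interp 𝐁 f xs
  where open Setoid X

-- A variety enters only through its signature and its membership
-- condition; the equational axiomatisability of the classes below is not
-- part of the data.

record AlgebraClass (a ℓ : Level) : Set (suc (a ⊔ ℓ)) where
  field
    signature : Signature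
    Member    : {X : Setoid a ℓ} → Algebra signature X → Set (a ⊔ ℓ)

open AlgebraClass public

record TermEquivalent (V W : AlgebraClass a ℓ) : Set (suc (a ⊔ ℓ)) where
  field
    W-in-V : Translation (signature W) (signature V)
    V-in-W : Translation (signature V) (signature W)

    V⇒W : {X : Setoid a ℓ} (𝐀 : Algebra (signature V) X) →
          Member V 𝐀 → Member W (derived W-in-V 𝐀)
    W⇒V : {X : Setoid a ℓ} (𝐁 : Algebra (signature W) X) →
          Member W 𝐁 → Member V (derived V-in-W 𝐁)

    V⇒W⇒V : {X : Setoid a ℓ} (𝐀 : Algebra (signature V) X) →
            Member V 𝐀 → derived V-in-W (derived W-in-V 𝐀) ≐ 𝐀
    W⇒V⇒W : {X : Setoid a ℓ} (𝐁 : Algebra (signature W) X) →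
            Member W 𝐁 → derived W-in-V (derived V-in-W 𝐁) ≐ 𝐁

module Axioms (X : Setoid a ℓ) where
  open Setoid X using (_≈_) renaming (Carrier to A)
  open LatticeStructures _≈_ using (IsDistributiveLattice)
  open AlgebraStructures _≈_ using (IsCommutativeMonoid)

  module Order (_∧_ : Op₂ A) where
    open NaturalOrder _≈_ _∧_ public using (_≤_)

  record IsBoundedDistributiveLattice
    (_∧_ _∨_ : Op₂ A) (𝟘 𝟙 : A) : Set (a ⊔ ℓ) where
    open Order _∧_
    field
      isDistributiveLattice : IsDistributiveLattice _∨_ _∧_
      minimum               : Minimum _≤_ 𝟘
      maximum               : Maximum _≤_ 𝟙

  record IsDPAlgebra
    (_∧_ _∨_ : Op₂ A) (¬ D : Op₁ A) (𝟘 𝟙 : A) : Set (a ⊔ ℓ) where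
    open Order _∧_
    field
      isBoundedDistributiveLattice : IsBoundedDistributiveLattice _∧_ _∨_ 𝟘 𝟙
      ¬-disjoint : ∀ x → (x ∧ ¬ x) ≈ 𝟘
      ¬-greatest : ∀ x y → (x ∧ y) ≈ 𝟘 → y ≤ ¬ x
      D-covers   : ∀ x → (x ∨ D x) ≈ 𝟙
      D-smallest : ∀ x y → (x ∨ y) ≈ 𝟙 → D x ≤ y

  record IsRegularDPAlgebra
    (_∧_ _∨_ : Op₂ A) (¬ D : Op₁ A) (𝟘 𝟙 : A) : Set (a ⊔ ℓ) where
    open Order _∧_
    field
      isDPAlgebra : IsDPAlgebra _∧_ _∨_ ¬ D 𝟘 𝟙
      regular     : ∀ x y → (x ∧ D x) ≤ (y ∨ ¬ y)

  record IsC3DPAlgebra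
    (_∧_ _∨_ : Op₂ A) (¬ D : Op₁ A) (𝟘 c 𝟙 : A) : Set (a ⊔ ℓ) where
    field
      isRegularDPAlgebra : IsRegularDPAlgebra _∧_ _∨_ ¬ D 𝟘 𝟙
      ¬-stone            : ∀ x → (¬ x ∨ ¬ (¬ x)) ≈ 𝟙
      D-stone            : ∀ x → (D x ∧ D (D x)) ≈ 𝟘
      ¬c≈𝟘               : ¬ c ≈ 𝟘
      Dc≈𝟙               : D c ≈ 𝟙

  record IsOddSugiharaMonoid
    (_∧_ _∨_ _·_ : Op₂ A) (∼ : Op₁ A) (e : A) : Set (a ⊔ ℓ) where
    open Order _∧_
    field
      isDistributiveLattice : IsDistributiveLattice _∨_ _∧_
      isCommutativeMonoid   : IsCommutativeMonoid _·_ e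
      square-increasing     : ∀ x → x ≤ (x · x)
      ∼-involutive          : ∀ x → ∼ (∼ x) ≈ x
      ∼-contraposition      : ∀ x y z → (z · x) ≤ y → (z · ∼ y) ≤ ∼ x
      ∼e≈e                  : ∼ e ≈ e

  record IsBoundedOddSugiharaMonoid
    (_∧_ _∨_ _·_ : Op₂ A) (∼ : Op₁ A) (𝟘 e 𝟙 : A) : Set (a ⊔ ℓ) where
    open Order _∧_
    field
      isOddSugiharaMonoid : IsOddSugiharaMonoid _∧_ _∨_ _·_ ∼ e
      minimum             : Minimum _≤_ 𝟘
      maximum             : Maximum _≤_ 𝟙

  record IsB3SMonoid
    (_∧_ _∨_ _·_ : Op₂ A) (∼ : Op₁ A) (𝟘 e 𝟙 : A) : Set (a ⊔ ℓ) where
    open Order _∧_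
    field
      isBoundedOddSugiharaMonoid : IsBoundedOddSugiharaMonoid _∧_ _∨_ _·_ ∼ 𝟘 e 𝟙
      three-valued               : ∀ x → e ≤ (x ∨ ∼ (x · 𝟙))

  record Is3ŁAlgebra
    (_∧_ _∨_ : Op₂ A) (∼ ∇ : Op₁ A) (𝟘 𝟙 : A) : Set (a ⊔ ℓ) where
    field
      isBoundedDistributiveLattice : IsBoundedDistributiveLattice _∧_ _∨_ 𝟘 𝟙
      ∼-involutive : ∀ x → ∼ (∼ x) ≈ x
      ∼-deMorgan   : ∀ x y → ∼ (x ∧ y) ≈ (∼ x ∨ ∼ y)
      ∼∨∇          : ∀ x → (∼ x ∨ ∇ x) ≈ 𝟙
      ∼∧∇          : ∀ x → (x ∧ ∼ x) ≈ (∼ x ∧ ∇ x)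
      ∇-∧          : ∀ x y → ∇ (x ∧ y) ≈ (∇ x ∧ ∇ y)

  record IsC3ŁAlgebra
    (_∧_ _∨_ : Op₂ A) (∼ ∇ : Op₁ A) (𝟘 z 𝟙 : A) : Set (a ⊔ ℓ) where
    field
      is3ŁAlgebra : Is3ŁAlgebra _∧_ _∨_ ∼ ∇ 𝟘 𝟙
      ∼z≈z        : ∼ z ≈ z

  record IsC3MVAlgebra
    (_⊕_ : Op₂ A) (∼ : Op₁ A) (𝟘 c : A) : Set (a ⊔ ℓ) where
    field
      isCommutativeMonoid : IsCommutativeMonoid _⊕_ 𝟘
      ∼-involutive        : ∀ x → ∼ (∼ x) ≈ x
      ∼𝟘-absorbing        : ∀ x → (x ⊕ ∼ 𝟘) ≈ ∼ 𝟘
      łukasiewicz         : ∀ x y → (∼ (∼ x ⊕ y) ⊕ y) ≈ (∼ (∼ y ⊕ x) ⊕ x)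
      three-valued        : ∀ x → (x ⊕ (x ⊕ x)) ≈ (x ⊕ x)
      ∼c≈c                : ∼ c ≈ c

data C3DPOp : Set where
  meet join pcomp dpcomp bot core top : C3DPOp

C3DPSig : Signature
C3DPSig = record { Op = C3DPOp ; arity = ar }
  where
  ar : C3DPOp → ℕ
  ar meet   = 2
  ar join   = 2
  ar pcomp  = 1
  ar dpcomp = 1
  ar bot    = 0
  ar core   = 0
  ar top    = 0

C3DP : (a ℓ : Level) → AlgebraClass a ℓ
C3DP a ℓ = record
  { signature = C3DPSig
  ; Member    = λ {X} 𝐀 → Axioms.IsC3DPAlgebra X
      (λ x y → interp 𝐀 meet (x ∷ y ∷ []))
      (λ x y → interp 𝐀 join (x ∷ y ∷ []))
      (λ x → interp 𝐀 pcomp (x ∷ []))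
      (λ x → interp 𝐀 dpcomp (x ∷ []))
      (interp 𝐀 bot [])
      (interp 𝐀 core [])
      (interp 𝐀 top [])
  }

data B3SMOp : Set where
  meet join mul inv bot unit top : B3SMOp

B3SMSig : Signature
B3SMSig = record { Op = B3SMOp ; arity = ar }
  where
  ar : B3SMOp → ℕ
  ar meet = 2
  ar join = 2
  ar mul  = 2
  ar inv  = 1
  ar bot  = 0
  ar unit = 0
  ar top  = 0

B3SM : (a ℓ : Level) → AlgebraClass a ℓ
B3SM a ℓ = record
  { signature = B3SMSig
  ; Member    = λ {X} 𝐀 → Axioms.IsB3SMonoid X
      (λ x y → interp 𝐀 meet (x ∷ y ∷ []))
      (λ x y → interp 𝐀 join (x ∷ y ∷ []))
      (λ x y → interp 𝐀 mul (x ∷ y ∷ []))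
      (λ x → interp 𝐀 inv (x ∷ []))
      (interp 𝐀 bot [])
      (interp 𝐀 unit [])
      (interp 𝐀 top [])
  }

data C3ŁOp : Set where
  meet join inv poss bot centre top : C3ŁOp

C3ŁSig : Signature
C3ŁSig = record { Op = C3ŁOp ; arity = ar }
  where
  ar : C3ŁOp → ℕ
  ar meet   = 2
  ar join   = 2
  ar inv    = 1
  ar poss   = 1
  ar bot    = 0
  ar centre = 0
  ar top    = 0

C3Ł : (a ℓ : Level) → AlgebraClass a ℓ
C3Ł a ℓ = record
  { signature = C3ŁSig
  ; Member    = λ {X} 𝐀 → Axioms.IsC3ŁAlgebra X
      (λ x y → interp 𝐀 meet (x ∷ y ∷ []))
      (λ x y → interp 𝐀 join (x ∷ y ∷ []))
      (λ x → interp 𝐀 inv (x ∷ []))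
      (λ x → interp 𝐀 poss (x ∷ []))
      (interp 𝐀 bot [])
      (interp 𝐀 centre [])
      (interp 𝐀 top [])
  }

data C3MVOp : Set where
  plus inv zero centre : C3MVOp

C3MVSig : Signature
C3MVSig = record { Op = C3MVOp ; arity = ar }
  where
  ar : C3MVOp → ℕ
  ar plus   = 2
  ar inv    = 1
  ar zero   = 0
  ar centre = 0

C3MV : (a ℓ : Level) → AlgebraClass a ℓ
C3MV a ℓ = record
  { signature = C3MVSig
  ; Member    = λ {X} 𝐀 → Axioms.IsC3MVAlgebra X
      (λ x y → interp 𝐀 plus (x ∷ y ∷ []))
      (λ x → interp 𝐀 inv (x ∷ []))
      (interp 𝐀 zero [])
      (interp 𝐀 centre [])
  }

{-# OPTIONS --safe #-}
module Submission where

-- Each of the four classes consists of exactly the algebras satisfying every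
-- identity of one three-element algebra on 𝟎 < ½ < 𝟏.  For a member 𝐀 this is a
-- Shannon expansion: a central element p gives the congruence "x and y agree on
-- p", and for every x the unit splits into central pieces on which x is
-- congruent to 𝟎, ½ or 𝟏, so an identity needs to be tested on these constants
-- only.  Conversely the axioms are identities, or quasi-identities that follow
-- from identities, checked by running through the three values.  Since an
-- interpretation between three-element algebras carries identities along, term
-- equivalence reduces to mutual interpretations of the three-element algebras,
-- and these compose through the Łukasiewicz chain.

open import Defs
open import Level using (Level; _⊔_; Lift; lift) renaming (suc to lsuc)
open import Algebra.Bundles using (CommutativeMonoid)
open import Algebra.Core using (Op₁; Op₂)
import Algebra.Properties.CommutativeSemigroup as CommutativeSemigroupProperties
import Algebra.Structures as AlgebraStructures
import Algebra.Structures.Biased as BiasedStructures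
open import Algebra.Lattice.Bundles using (Lattice)
import Algebra.Lattice.Structures as LatticeStructures
import Algebra.Lattice.Structures.Biased as BiasedLatticeStructures
import Algebra.Lattice.Properties.Lattice as LatticeProperties
open import Data.Fin.Base using (Fin; zero; suc)
open import Data.Fin.Properties using (_≟_; all?)
open import Data.List.Base using ([]; _∷_)
open import Data.List.Relation.Unary.All using ([]; _∷_)
open import Data.List.Relation.Unary.AllPairs using (AllPairs; []; _∷_)
open import Data.Nat.Base using (ℕ; zero; suc)
open import Data.Product.Base using (_×_; _,_; proj₁; proj₂; Σ)
open import Data.Unit.Base using (⊤; tt)
open import Data.Vec.Base using (Vec; []; _∷_; map; tabulate)
open import Data.Vec.Properties using (tabulate∘lookup)
open import Data.Vec.Relation.Binary.Pointwise.Inductive as Pointwise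
  using (Pointwise; []; _∷_)
open import Relation.Binary.Bundles using (Setoid)
open import Relation.Binary.Structures using (IsEquivalence)
import Relation.Binary.Lattice as OrderLattice
import Relation.Binary.Reasoning.PartialOrder as PartialOrderReasoning
import Relation.Binary.Reasoning.Setoid as SetoidReasoning
open import Relation.Binary.PropositionalEquality as ≡ using (_≡_; refl)
open import Relation.Nullary.Decidable using (Dec; True; toWitness; map′)

-- Embedding each member into a power of the three-element algebra would be the classical route, but
-- it needs prime filters. Cutting along the finitely many elements assigned to the variables of an
-- identity is a choice-free substitute that works over an arbitrary setoid. The cut is possible
-- because the centre is a constant of the signature: the middle piece of x is where x agrees with a
-- named element, so all three values are available inside the algebra. What has to be found in each
-- class are two two-valued elements derived from x, playing the roles of ∇ x and ∇ (∼ x): `¬ (¬ x)`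
-- and `D x`, `𝟙 · x` and `𝟙 · ∼ x`, or `x ⊕ x` and `∼ x ⊕ ∼ x`. The MV axioms do not start from a
-- lattice, so there the cut is made by adding an idempotent q instead of meeting with p.

private
  variable
    a b ℓ ℓ₁ ℓ₂ : Level
    m n : ℕ
    S T U : Signature
    X : Setoid a ℓ
    Y : Setoid b ℓ₁

-- Terms, translations and identities

module _ (𝐁 : Algebra S Y) (𝐀 : Algebra S X)
  (R : Setoid.Carrier Y → Setoid.Carrier X → Set ℓ₂)
  (preserved : ∀ f {xs ys} → Pointwise R xs ys → R (interp 𝐁 f xs) (interp 𝐀 f ys))
  where

  mutual
    -- The fundamental lemma of logical relations. A relation is used instead of a homomorphism
    -- because the instances relate terms to their values, setoid-equal elements, and truth values
    -- to elements that are only locally equal to them.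
    eval-related : (t : Term S n) → ∀ {ρ σ} → Pointwise R ρ σ →
                   R (eval 𝐁 t ρ) (eval 𝐀 t σ)
    eval-related (var i)    ρRσ = Pointwise.lookup ρRσ i
    eval-related (app f ts) ρRσ = preserved f (evals-related ts ρRσ)

    evals-related : (ts : Vec (Term S n) m) → ∀ {ρ σ} → Pointwise R ρ σ →
                    Pointwise R (evals 𝐁 ts ρ) (evals 𝐀 ts σ)
    evals-related []       ρRσ = []
    evals-related (t ∷ ts) ρRσ = eval-related t ρRσ ∷ evals-related ts ρRσ

termAlgebra : (S : Signature) (n : ℕ) → Algebra S (≡.setoid (Term S n))
termAlgebra S n = record
  { interp = app
  ; cong   = λ f ts≡us → ≡.cong (app f) (Pointwise.Pointwise-≡⇒≡ ts≡us)
  }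

-- Substitution is obtained as evaluation in the derived term algebra, at the variables themselves;
-- its correctness then becomes an instance of `eval-related`.
translate : Translation S T → Term S n → Term T n
translate {T = T} {n = n} τ t = eval (derived τ (termAlgebra T n)) t (tabulate var)

module _ (𝐀 : Algebra S X) where
  open Setoid X renaming (refl to ≈-refl)

  evaluates-variables : (ρ : Vec Carrier n) →
    Pointwise (λ t x → eval 𝐀 t ρ ≈ x) (tabulate var) ρ
  evaluates-variables ρ =
    ≡.subst (Pointwise _ (tabulate var)) (tabulate∘lookup ρ)
      (Pointwise.tabulate⁺ (λ _ → ≈-refl))

  evals-pointwise : ∀ {ρ : Vec Carrier n} {ts : Vec (Term S n) m} {xs : Vec Carrier m} →
    Pointwise (λ t x → eval 𝐀 t ρ ≈ x) ts xs → Pointwise _≈_ (evals 𝐀 ts ρ) xs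
  evals-pointwise []       = []
  evals-pointwise (p ∷ ps) = p ∷ evals-pointwise ps

  eval-generic : ∀ f (xs : Vec Carrier (arity S f)) →
    eval 𝐀 (app f (tabulate var)) xs ≈ interp 𝐀 f xs
  eval-generic f xs = cong 𝐀 f (evals-pointwise (evaluates-variables xs))

module _ (τ : Translation S T) (𝐀 : Algebra T X) where
  open Setoid X

  -- The relation "this term has this value" is preserved by the operations of T, hence by every
  -- term `τ f`, hence by the derived operations of S: two nested uses of `eval-related`.
  eval-translate : (t : Term S n) (ρ : Vec Carrier n) →
    eval 𝐀 (translate τ t) ρ ≈ eval (derived τ 𝐀) t ρ
  eval-translate {n = n} t ρ =
    eval-related (derived τ (termAlgebra T n)) (derived τ 𝐀) R
      (λ f → eval-related (termAlgebra T n) 𝐀 R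
        (λ g p → cong 𝐀 g (evals-pointwise 𝐀 p)) (τ f))
      t (evaluates-variables 𝐀 ρ)
    where
    R : Term T n → Carrier → Set _
    R s x = eval 𝐀 s ρ ≈ x

eval-≐ : {𝐀 𝐁 : Algebra S X} → 𝐀 ≐ 𝐁 → (t : Term S n) → ∀ ρ →
         Setoid._≈_ X (eval 𝐀 t ρ) (eval 𝐁 t ρ)
eval-≐ {X = X} {𝐀 = 𝐀} {𝐁} 𝐀≐𝐁 t ρ =
  eval-related 𝐀 𝐁 _≈_ (λ f {_} {ys} p → trans (cong 𝐀 f p) (𝐀≐𝐁 f ys)) t
    (Pointwise.refl ≈-refl)
  where open Setoid X renaming (refl to ≈-refl)

-- Theories of three-element algebras and interpretations between them

Three : Set
Three = Fin 3

pattern 𝟎 = zero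
pattern ½ = suc zero
pattern 𝟏 = suc (suc zero)

ThreeAlgebra : Signature → Set
ThreeAlgebra S = Algebra S (≡.setoid Three)

threeAlgebra : ((f : Op S) → Vec Three (arity S f) → Three) → ThreeAlgebra S
threeAlgebra i = record
  { interp = i
  ; cong   = λ f p → ≡.cong (i f) (Pointwise.Pointwise-≡⇒≡ p)
  }

infix 4 _⊨Th_ _⟶_

_⊨Th_ : Algebra S X → ThreeAlgebra S → Set _
_⊨Th_ {S = S} {X = X} 𝐀 𝟛 = ∀ {n} (s t : Term S n) →
  (∀ ρ → eval 𝟛 s ρ ≡ eval 𝟛 t ρ) → ∀ ρ → eval 𝐀 s ρ ≈ eval 𝐀 t ρ
  where open Setoid X

-- An interpretation of 𝐒 in 𝐓. The arrow follows the passage of algebras, from T-algebras to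
-- derived S-algebras, and so runs against the translation of terms.
record _⟶_ (𝐓 : ThreeAlgebra T) (𝐒 : ThreeAlgebra S) : Set where
  field
    translation : Translation S T
    correct     : derived translation 𝐓 ≐ 𝐒

open _⟶_

module _ {𝐓 : ThreeAlgebra T} {𝐒 : ThreeAlgebra S} (τ : 𝐓 ⟶ 𝐒) where

  eval-translate-three : (t : Term S n) → ∀ ρ →
    eval 𝐓 (translate (translation τ) t) ρ ≡ eval 𝐒 t ρ
  eval-translate-three t ρ =
    ≡.trans (eval-translate (translation τ) 𝐓 t ρ) (eval-≐ {𝐁 = 𝐒} (correct τ) t ρ)

  ⊨Th-derived : (𝐀 : Algebra T X) → 𝐀 ⊨Th 𝐓 → derived (translation τ) 𝐀 ⊨Th 𝐒
  ⊨Th-derived {X = X} 𝐀 𝐀⊨ s t s≡t ρ = begin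
    eval (derived (translation τ) 𝐀) s ρ   ≈⟨ eval-translate (translation τ) 𝐀 s ρ ⟨
    eval 𝐀 (translate (translation τ) s) ρ
      ≈⟨ 𝐀⊨ (translate (translation τ) s) (translate (translation τ) t) translated ρ ⟩
    eval 𝐀 (translate (translation τ) t) ρ ≈⟨ eval-translate (translation τ) 𝐀 t ρ ⟩
    eval (derived (translation τ) 𝐀) t ρ   ∎
    where
    open SetoidReasoning X
    translated : ∀ σ → eval 𝐓 (translate (translation τ) s) σ ≡
                       eval 𝐓 (translate (translation τ) t) σ
    translated σ = ≡.trans (eval-translate-three s σ)
      (≡.trans (s≡t σ) (≡.sym (eval-translate-three t σ)))

infixr 9 _⟫_

_⟫_ : {𝐔 : ThreeAlgebra U} {𝐓 : ThreeAlgebra T} {𝐒 : ThreeAlgebra S} →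
      𝐔 ⟶ 𝐓 → 𝐓 ⟶ 𝐒 → 𝐔 ⟶ 𝐒
τ ⟫ σ = record
  { translation = λ f → translate (translation τ) (translation σ f)
  ; correct     = λ f xs →
      ≡.trans (eval-translate-three τ (translation σ f) xs) (correct σ f xs)
  }

-- That the doubly translated operation f is f again is itself an identity, between a composite term
-- and `app f` at the variables. It holds in 𝐓 by correctness of both interpretations, hence in 𝐀.
round-trip : {𝐓 : ThreeAlgebra T} {𝐒 : ThreeAlgebra S}
  (τ : 𝐓 ⟶ 𝐒) (σ : 𝐒 ⟶ 𝐓) (𝐀 : Algebra T X) → 𝐀 ⊨Th 𝐓 →
  derived (translation σ) (derived (translation τ) 𝐀) ≐ 𝐀
round-trip {X = X} {𝐓 = 𝐓} τ σ 𝐀 𝐀⊨ f xs = begin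
  eval (derived (translation τ) 𝐀) (translation σ f) xs
    ≈⟨ eval-translate (translation τ) 𝐀 (translation σ f) xs ⟨
  eval 𝐀 (translate (translation τ) (translation σ f)) xs
    ≈⟨ 𝐀⊨ (translate (translation τ) (translation σ f)) (app f (tabulate var)) generic xs ⟩
  eval 𝐀 (app f (tabulate var)) xs
    ≈⟨ eval-generic 𝐀 f xs ⟩
  interp 𝐀 f xs
    ∎
  where
  open SetoidReasoning X
  generic : ∀ ρ → eval 𝐓 (translate (translation τ) (translation σ f)) ρ ≡
                  eval 𝐓 (app f (tabulate var)) ρ
  generic ρ = ≡.trans (correct (τ ⟫ σ) f ρ) (≡.sym (eval-generic 𝐓 f ρ))

record DeterminedBy (V : AlgebraClass a ℓ) (𝟛 : ThreeAlgebra (signature V)) :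
  Set (lsuc (a ⊔ ℓ)) where
  field
    Member⇒⊨Th : {X : Setoid a ℓ} (𝐀 : Algebra (signature V) X) → Member V 𝐀 → 𝐀 ⊨Th 𝟛
    ⊨Th⇒Member : {X : Setoid a ℓ} (𝐀 : Algebra (signature V) X) → 𝐀 ⊨Th 𝟛 → Member V 𝐀

open DeterminedBy

termEquivalent : {V W : AlgebraClass a ℓ}
  {𝐕 : ThreeAlgebra (signature V)} {𝐖 : ThreeAlgebra (signature W)} →
  DeterminedBy V 𝐕 → DeterminedBy W 𝐖 → 𝐕 ⟶ 𝐖 → 𝐖 ⟶ 𝐕 → TermEquivalent V W
termEquivalent dV dW τ σ = record
  { W-in-V = translation τ
  ; V-in-W = translation σ
  ; V⇒W    = λ 𝐀 m → ⊨Th⇒Member dW _ (⊨Th-derived τ 𝐀 (Member⇒⊨Th dV 𝐀 m))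
  ; W⇒V    = λ 𝐁 m → ⊨Th⇒Member dV _ (⊨Th-derived σ 𝐁 (Member⇒⊨Th dW 𝐁 m))
  ; V⇒W⇒V  = λ 𝐀 m → round-trip τ σ 𝐀 (Member⇒⊨Th dV 𝐀 m)
  ; W⇒V⇒W  = λ 𝐁 m → round-trip σ τ 𝐁 (Member⇒⊨Th dW 𝐁 m)
  }

-- Deciding identities of three-element algebras

allVec? : {P : Vec Three n → Set} → (∀ ρ → Dec (P ρ)) → Dec (∀ ρ → P ρ)
allVec? {zero}  P? = map′ (λ { p [] → p }) (λ p → p []) (P? [])
allVec? {suc n} P? =
  map′ (λ { p (v ∷ ρ) → p v ρ }) (λ p v ρ → p (v ∷ ρ))
    (all? (λ v → allVec? (λ ρ → P? (v ∷ ρ))))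

infix 1 _≑_

_≑_ : Term S n → Term S n → Term S n × Term S n
_≑_ = _,_

module Laws (𝐀 : Algebra S X) (𝟛 : ThreeAlgebra S) (𝐀⊨ : 𝐀 ⊨Th 𝟛) where
  open Setoid X

  valid? : (e : Term S n × Term S n) →
    Dec (∀ ρ → eval 𝟛 (proj₁ e) ρ ≡ eval 𝟛 (proj₂ e) ρ)
  valid? e = allVec? (λ ρ → eval 𝟛 (proj₁ e) ρ ≟ eval 𝟛 (proj₂ e) ρ)

  -- For a closed pair of terms the implicit argument computes to the unit type, so type checking an
  -- application evaluates both sides at all assignments.
  law : (e : Term S n × Term S n) → {True (valid? e)} →
    ∀ ρ → eval 𝐀 (proj₁ e) ρ ≈ eval 𝐀 (proj₂ e) ρ
  law e {v} = 𝐀⊨ (proj₁ e) (proj₂ e) (toWitness v)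

  law₁ : (e : Term S 1 → Term S 1 × Term S 1) →
    let e′ = e (var zero) in
    {True (valid? e′)} → ∀ x →
    eval 𝐀 (proj₁ e′) (x ∷ []) ≈ eval 𝐀 (proj₂ e′) (x ∷ [])
  law₁ e {v} x = law (e (var zero)) {v} (x ∷ [])

  law₂ : (e : (_ _ : Term S 2) → Term S 2 × Term S 2) →
    let e′ = e (var zero) (var (suc zero)) in
    {True (valid? e′)} → ∀ x y →
    eval 𝐀 (proj₁ e′) (x ∷ y ∷ []) ≈ eval 𝐀 (proj₂ e′) (x ∷ y ∷ [])
  law₂ e {v} x y = law (e (var zero) (var (suc zero))) {v} (x ∷ y ∷ [])

  law₃ : (e : (_ _ _ : Term S 3) → Term S 3 × Term S 3) →
    let e′ = e (var zero) (var (suc zero)) (var (suc (suc zero))) in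
    {True (valid? e′)} → ∀ x y z →
    eval 𝐀 (proj₁ e′) (x ∷ y ∷ z ∷ []) ≈ eval 𝐀 (proj₂ e′) (x ∷ y ∷ z ∷ [])
  law₃ e {v} x y z =
    law (e (var zero) (var (suc zero)) (var (suc (suc zero)))) {v} (x ∷ y ∷ z ∷ [])

-- Locally three-valued algebras

-- An interface shared by two mirror-image situations: loci p with agreement after meeting with p,
-- and loci q with agreement after adding q. A locus carries its evidence of centrality, which is
-- why it has its own level.
record LocallyThree (i : Level) {X : Setoid a ℓ} (𝐀 : Algebra S X) (𝟛 : ThreeAlgebra S) :
  Set (a ⊔ lsuc ℓ ⊔ lsuc i) where
  open Setoid X using (Carrier; _≈_)
  field
    Locus            : Set i
    _≈[_]_           : Carrier → Locus → Carrier → Set ℓ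
    isEquivalence    : ∀ p → IsEquivalence (λ x y → x ≈[ p ] y)
    congruence       : ∀ p f {xs ys} → Pointwise (λ x y → x ≈[ p ] y) xs ys →
                       interp 𝐀 f xs ≈[ p ] interp 𝐀 f ys
    constant         : Three → Carrier
    constant-hom     : ∀ p f vs →
                       interp 𝐀 f (map constant vs) ≈[ p ] constant (interp 𝟛 f vs)
    everywhere       : Locus
    everywhere-sound : ∀ {x y} → x ≈[ everywhere ] y → x ≈ y
    piece            : Locus → Carrier → Three → Locus
    restrict         : ∀ {p z x y} v → x ≈[ p ] y → x ≈[ piece p z v ] y
    piece-constant   : ∀ {p x} v → x ≈[ piece p x v ] constant v
    glue             : ∀ {p z x y} → (∀ v → x ≈[ piece p z v ] y) → x ≈[ p ] y

  -- Q records the values already assigned to the variables in front of ρ.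
  locally-constant : ∀ {x y} (Q : Locus → Set ℓ) → (∀ {p z} v → Q p → Q (piece p z v)) →
    (ρ : Vec Carrier n) →
    (∀ {p} (vs : Vec Three n) → Q p → Pointwise (λ v z → z ≈[ p ] constant v) vs ρ → x ≈[ p ] y) →
    ∀ {p} → Q p → x ≈[ p ] y
  locally-constant Q Q-restrict []      h q = h [] q []
  locally-constant Q Q-restrict (z ∷ ρ) h q = glue λ v →
    locally-constant (λ p → Q p × z ≈[ p ] constant v)
      (λ { w (q , z≈v) → Q-restrict w q , restrict w z≈v }) ρ
      (λ { vs (q , z≈v) p → h (v ∷ vs) q (z≈v ∷ p) })
      (Q-restrict v q , piece-constant v)

  eval-constant : ∀ {p} (t : Term S n) {vs : Vec Three n} {ρ} →
    Pointwise (λ v z → z ≈[ p ] constant v) vs ρ →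
    eval 𝐀 t ρ ≈[ p ] constant (eval 𝟛 t vs)
  eval-constant {p = p} = eval-related 𝟛 𝐀 (λ v z → z ≈[ p ] constant v) λ f {vs} q →
    IsEquivalence.trans (isEquivalence p) (congruence p f (flip q)) (constant-hom p f vs)
    where
    flip : ∀ {vs : Vec Three m} {zs : Vec Carrier m} → Pointwise (λ v z → z ≈[ p ] constant v) vs zs →
           Pointwise (λ x y → x ≈[ p ] y) zs (map constant vs)
    flip []       = []
    flip (q ∷ qs) = q ∷ flip qs

  locallyThree⇒⊨Th : 𝐀 ⊨Th 𝟛
  locallyThree⇒⊨Th s t s≡t ρ = everywhere-sound
    (locally-constant (λ _ → Lift ℓ ⊤) (λ _ q → q) ρ agree (lift tt))
    where
    agree : ∀ {p} (vs : Vec Three _) → Lift ℓ ⊤ → Pointwise (λ v z → z ≈[ p ] constant v) vs ρ →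
            eval 𝐀 s ρ ≈[ p ] eval 𝐀 t ρ
    agree {p} vs _ q = trans (eval-constant s q)
      (trans (reflexive (≡.cong constant (s≡t vs))) (sym (eval-constant t q)))
      where open IsEquivalence (isEquivalence p)

-- The three-element algebras

infixr 7 _⊓_
infixr 6 _⊻_

-- `_·₃_` is the product of the Sugihara chain -1 < 0 < 1, whose unit 0 is written ½; `_⊕₃_` is
-- addition on 0, 1/2, 1 truncated at 1.
_⊓_ _⊻_ _·₃_ _⊕₃_ : Op₂ Three
𝟎 ⊓ v = 𝟎
½ ⊓ 𝟎 = 𝟎
½ ⊓ _ = ½
𝟏 ⊓ v = v

𝟎 ⊻ v = v
½ ⊻ 𝟏 = 𝟏
½ ⊻ _ = ½
𝟏 ⊻ v = 𝟏

𝟎 ·₃ v = 𝟎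
½ ·₃ v = v
𝟏 ·₃ 𝟎 = 𝟎
𝟏 ·₃ _ = 𝟏

𝟎 ⊕₃ v = v
½ ⊕₃ 𝟎 = ½
½ ⊕₃ _ = 𝟏
𝟏 ⊕₃ v = 𝟏

¬₃ D₃ ∼₃ ∇₃ : Op₁ Three
¬₃ 𝟎 = 𝟏
¬₃ _ = 𝟎

D₃ 𝟏 = 𝟎
D₃ _ = 𝟏

∼₃ 𝟎 = 𝟏
∼₃ ½ = ½
∼₃ 𝟏 = 𝟎

∇₃ 𝟎 = 𝟎
∇₃ _ = 𝟏

c3dp : ThreeAlgebra C3DPSig
c3dp = threeAlgebra λ
  { meet   (u ∷ v ∷ []) → u ⊓ v
  ; join   (u ∷ v ∷ []) → u ⊻ v
  ; pcomp  (u ∷ [])     → ¬₃ u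
  ; dpcomp (u ∷ [])     → D₃ u
  ; bot    []           → 𝟎
  ; core   []           → ½
  ; top    []           → 𝟏
  }

b3sm : ThreeAlgebra B3SMSig
b3sm = threeAlgebra λ
  { meet (u ∷ v ∷ []) → u ⊓ v
  ; join (u ∷ v ∷ []) → u ⊻ v
  ; mul  (u ∷ v ∷ []) → u ·₃ v
  ; inv  (u ∷ [])     → ∼₃ u
  ; bot  []           → 𝟎
  ; unit []           → ½
  ; top  []           → 𝟏
  }

c3ł : ThreeAlgebra C3ŁSig
c3ł = threeAlgebra λ
  { meet   (u ∷ v ∷ []) → u ⊓ v
  ; join   (u ∷ v ∷ []) → u ⊻ v
  ; inv    (u ∷ [])     → ∼₃ u
  ; poss   (u ∷ [])     → ∇₃ u
  ; bot    []           → 𝟎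
  ; centre []           → ½
  ; top    []           → 𝟏
  }

c3mv : ThreeAlgebra C3MVSig
c3mv = threeAlgebra λ
  { plus   (u ∷ v ∷ []) → u ⊕₃ v
  ; inv    (u ∷ [])     → ∼₃ u
  ; zero   []           → 𝟎
  ; centre []           → ½
  }

-- Bounded distributive lattices

module BoundedDistributiveLattice {X : Setoid a ℓ}
  {_∧_ _∨_ : Op₂ (Setoid.Carrier X)} {𝟘 𝟙 : Setoid.Carrier X}
  (isBoundedDistributiveLattice : Axioms.IsBoundedDistributiveLattice X _∧_ _∨_ 𝟘 𝟙)
  where

  open Axioms.IsBoundedDistributiveLattice isBoundedDistributiveLattice public
  open LatticeStructures.IsDistributiveLattice isDistributiveLattice public
    using (isLattice; ∧-cong; ∨-cong; ∧-comm; ∧-assoc; ∧-distribˡ-∨)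

  open Setoid X public using (_≈_) renaming (Carrier to A)

  lattice : Lattice a ℓ
  lattice = record { isLattice = isLattice }

  open OrderLattice.Lattice (LatticeProperties.∨-∧-orderTheoreticLattice lattice) public
    using (_≤_; poset; antisym; x≤x∨y; y≤x∨y; ∨-least; x∧y≤x; x∧y≤y; ∧-greatest; module Eq)
    renaming (refl to ≤-refl; trans to ≤-trans; reflexive to ≤-reflexive)

  open PartialOrderReasoning poset public

  private
    variable
      p q x y z w : A

  ∧-mono : x ≤ y → z ≤ w → (x ∧ z) ≤ (y ∧ w)
  ∧-mono x≤y z≤w = ∧-greatest (≤-trans (x∧y≤x _ _) x≤y) (≤-trans (x∧y≤y _ _) z≤w)

  ∨-mono : x ≤ y → z ≤ w → (x ∨ z) ≤ (y ∨ w)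
  ∨-mono x≤y z≤w = ∨-least (≤-trans x≤y (x≤x∨y _ _)) (≤-trans z≤w (y≤x∨y _ _))

  ∧-∨-least : (z ∧ x) ≤ w → (z ∧ y) ≤ w → (z ∧ (x ∨ y)) ≤ w
  ∧-∨-least zx≤w zy≤w =
    ≤-trans (≤-reflexive (∧-distribˡ-∨ _ _ _)) (∨-least zx≤w zy≤w)

  by-cases : 𝟙 ≤ (x ∨ y) → (z ∧ x) ≤ w → (z ∧ y) ≤ w → z ≤ w
  by-cases 1≤x∨y zx≤w zy≤w =
    ≤-trans (∧-greatest ≤-refl (≤-trans (maximum _) 1≤x∨y)) (∧-∨-least zx≤w zy≤w)

  resolve : (p ∧ q) ≤ 𝟘 → (p ∧ (q ∨ x)) ≤ x
  resolve pq≤0 = ∧-∨-least (≤-trans pq≤0 (minimum _)) (x∧y≤y _ _)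

  Complements : A → A → Set ℓ
  Complements p q = (p ∧ q) ≤ 𝟘 × 𝟙 ≤ (p ∨ q)

  complements-sym : Complements p q → Complements q p
  complements-sym (pq≤0 , 1≤p∨q) =
    ≤-trans (∧-greatest (x∧y≤y _ _) (x∧y≤x _ _)) pq≤0 ,
    ≤-trans 1≤p∨q (∨-least (y≤x∨y _ _) (x≤x∨y _ _))

  complements-∧ : ∀ {p′ q′} → Complements p p′ → Complements q q′ →
                  Complements (p ∧ q) (p′ ∨ q′)
  complements-∧ (pp′≤0 , 1≤p∨p′) (qq′≤0 , 1≤q∨q′) =
    ∧-∨-least (≤-trans (∧-mono (x∧y≤x _ _) ≤-refl) pp′≤0)
              (≤-trans (∧-mono (x∧y≤y _ _) ≤-refl) qq′≤0) ,
    by-cases 1≤p∨p′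
      (by-cases 1≤q∨q′
        (≤-trans (∧-mono (x∧y≤y _ _) ≤-refl) (x≤x∨y _ _))
        (≤-trans (x∧y≤y _ _) (≤-trans (y≤x∨y _ _) (y≤x∨y _ _))))
      (≤-trans (x∧y≤y _ _) (≤-trans (x≤x∨y _ _) (y≤x∨y _ _)))

  complements-𝟙 : Complements 𝟙 𝟘
  complements-𝟙 = x∧y≤y _ _ , x≤x∨y _ _

  infix 4 _≈[_]_

  -- For every p this respects meets and, by distributivity, joins. Centrality of p enters only with
  -- further operations, as in `D-≈[]`, `∼-≈[]` and `·-≈[]`.
  _≈[_]_ : A → A → A → Set ℓ
  x ≈[ p ] y = (p ∧ x) ≈ (p ∧ y)

  ≈[]-isEquivalence : ∀ p → IsEquivalence (λ x y → x ≈[ p ] y)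
  ≈[]-isEquivalence p = record
    { refl  = Eq.refl
    ; sym   = Eq.sym
    ; trans = Eq.trans
    }

  ≈⇒≈[] : x ≈ y → x ≈[ p ] y
  ≈⇒≈[] = ∧-cong Eq.refl

  ≈[]⇒≤ : x ≈[ p ] y → (p ∧ x) ≤ y
  ≈[]⇒≤ x≈y = ≤-trans (≤-reflexive x≈y) (x∧y≤y _ _)

  ≈[]-antisym : (p ∧ x) ≤ y → (p ∧ y) ≤ x → x ≈[ p ] y
  ≈[]-antisym px≤y py≤x =
    antisym (∧-greatest (x∧y≤x _ _) px≤y) (∧-greatest (x∧y≤x _ _) py≤x)

  ≈[]-mono : q ≤ p → x ≈[ p ] y → x ≈[ q ] y
  ≈[]-mono q≤p x≈y = ≈[]-antisym
    (≤-trans (∧-mono q≤p ≤-refl) (≈[]⇒≤ x≈y))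
    (≤-trans (∧-mono q≤p ≤-refl) (≈[]⇒≤ (Eq.sym x≈y)))

  ≈[𝟙]⇒≈ : x ≈[ 𝟙 ] y → x ≈ y
  ≈[𝟙]⇒≈ x≈y = antisym
    (≤-trans (∧-greatest (maximum _) ≤-refl) (≈[]⇒≤ x≈y))
    (≤-trans (∧-greatest (maximum _) ≤-refl) (≈[]⇒≤ (Eq.sym x≈y)))

  ∧-≈[] : x ≈[ p ] y → z ≈[ p ] w → (x ∧ z) ≈[ p ] (y ∧ w)
  ∧-≈[] x≈y z≈w = ≈[]-antisym (below x≈y z≈w) (below (Eq.sym x≈y) (Eq.sym z≈w))
    where
    below : x ≈[ p ] y → z ≈[ p ] w → (p ∧ (x ∧ z)) ≤ (y ∧ w)
    below x≈y z≈w = ∧-greatest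
      (≤-trans (∧-mono ≤-refl (x∧y≤x _ _)) (≈[]⇒≤ x≈y))
      (≤-trans (∧-mono ≤-refl (x∧y≤y _ _)) (≈[]⇒≤ z≈w))

  ∨-≈[] : x ≈[ p ] y → z ≈[ p ] w → (x ∨ z) ≈[ p ] (y ∨ w)
  ∨-≈[] x≈y z≈w =
    Eq.trans (∧-distribˡ-∨ _ _ _)
      (Eq.trans (∨-cong x≈y z≈w) (Eq.sym (∧-distribˡ-∨ _ _ _)))

  constants : A → Three → A
  constants c 𝟎 = 𝟘
  constants c ½ = c
  constants c 𝟏 = 𝟙

  constants-∧ : ∀ {c} u v → (constants c u ∧ constants c v) ≈ constants c (u ⊓ v)
  constants-∧ 𝟎 v = antisym (x∧y≤x _ _) (minimum _)
  constants-∧ ½ 𝟎 = antisym (x∧y≤y _ _) (minimum _)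
  constants-∧ ½ ½ = antisym (x∧y≤x _ _) (∧-greatest ≤-refl ≤-refl)
  constants-∧ ½ 𝟏 = antisym (x∧y≤x _ _) (∧-greatest ≤-refl (maximum _))
  constants-∧ 𝟏 v = antisym (x∧y≤y _ _) (∧-greatest (maximum _) ≤-refl)

  constants-∨ : ∀ {c} u v → (constants c u ∨ constants c v) ≈ constants c (u ⊻ v)
  constants-∨ 𝟎 v = antisym (∨-least (minimum _) ≤-refl) (y≤x∨y _ _)
  constants-∨ ½ 𝟎 = antisym (∨-least ≤-refl (minimum _)) (x≤x∨y _ _)
  constants-∨ ½ ½ = antisym (∨-least ≤-refl ≤-refl) (x≤x∨y _ _)
  constants-∨ ½ 𝟏 = antisym (maximum _) (y≤x∨y _ _)
  constants-∨ 𝟏 v = antisym (maximum _) (x≤x∨y _ _)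

  -- On x₀ the element x is 𝟘, on x₂ it is 𝟙, and on the overlap of their
  -- complements it is the centre c.
  record Trisection (Central : A → Set ℓ₁) (c x : A) : Set (a ⊔ ℓ ⊔ ℓ₁) where
    field
      {x₀ x₀ᶜ x₂ x₂ᶜ} : A
      x₀-central  : Central x₀
      x₀ᶜ-central : Central x₀ᶜ
      x₂-central  : Central x₂
      x₂ᶜ-central : Central x₂ᶜ
      x₀-cover    : 𝟙 ≤ (x₀ ∨ x₀ᶜ)
      x₂-cover    : 𝟙 ≤ (x₂ ∨ x₂ᶜ)
      on-x₀       : (x₀ ∧ x) ≤ 𝟘
      on-x₂       : x₂ ≤ x
      middle-≤    : ((x₀ᶜ ∧ x₂ᶜ) ∧ x) ≤ c
      middle-≥    : ((x₀ᶜ ∧ x₂ᶜ) ∧ c) ≤ x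

    part : Three → A
    part 𝟎 = x₀
    part ½ = x₀ᶜ ∧ x₂ᶜ
    part 𝟏 = x₂

    part-constant : ∀ v → x ≈[ part v ] constants c v
    part-constant 𝟎 = ≈[]-antisym on-x₀ (≤-trans (x∧y≤y _ _) (minimum _))
    part-constant ½ = ≈[]-antisym middle-≤ middle-≥
    part-constant 𝟏 = ≈[]-antisym (maximum _) (≤-trans (x∧y≤x _ _) on-x₂)

    parts-cover : (∀ v → (z ∧ part v) ≤ w) → z ≤ w
    parts-cover h = by-cases x₀-cover (h 𝟎)
      (by-cases x₂-cover
        -- The part of value 𝟏 is all of `x₂`, so `x₀ᶜ` is dropped here; gluing tolerates
        -- overlapping parts.
        (≤-trans (∧-mono (x∧y≤x _ _) ≤-refl) (h 𝟏))
        (≤-trans (≤-reflexive (∧-assoc _ _ _)) (h ½)))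

  -- `Central` is a parameter because the evidence that makes agreement on p a congruence depends on
  -- the class: some complement, the complement ∼ p, or the latter together with closure under
  -- multiplication by 𝟙.
  locallyThree : (𝐀 : Algebra S X) (𝟛 : ThreeAlgebra S) (c : A) (Central : A → Set ℓ₁) →
    Central 𝟙 → (∀ {p q} → Central p → Central q → Central (p ∧ q)) →
    (∀ {p} → Central p → ∀ f {xs ys} → Pointwise (λ x y → x ≈[ p ] y) xs ys →
      interp 𝐀 f xs ≈[ p ] interp 𝐀 f ys) →
    (∀ f vs → interp 𝐀 f (map (constants c) vs) ≈ constants c (interp 𝟛 f vs)) →
    (∀ x → Trisection Central c x) →
    LocallyThree (a ⊔ ℓ₁) 𝐀 𝟛
  locallyThree 𝐀 𝟛 c Central central-𝟙 central-∧ central-cong constant-hom trisect = record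
    { Locus            = Σ A Central
    ; _≈[_]_           = λ x p y → x ≈[ proj₁ p ] y
    ; isEquivalence    = λ p → ≈[]-isEquivalence (proj₁ p)
    ; congruence       = λ p → central-cong (proj₂ p)
    ; constant         = constants c
    ; constant-hom     = λ p f vs → ≈⇒≈[] (constant-hom f vs)
    ; everywhere       = 𝟙 , central-𝟙
    ; everywhere-sound = ≈[𝟙]⇒≈
    ; piece            = λ p z v → (proj₁ p ∧ part z v) , central-∧ (proj₂ p) (part-central z v)
    ; restrict         = λ v → ≈[]-mono (x∧y≤x _ _)
    ; piece-constant   = λ {p} {x} v → ≈[]-mono (x∧y≤y _ _) (part-constant x v)
    ; glue             = λ {p} {z} x≈y → ≈[]-antisym
        (parts-cover z (λ v → below (x≈y v))) (parts-cover z (λ v → below (Eq.sym (x≈y v))))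
    }
    where
    open module T x = Trisection (trisect x) using (part; part-constant; parts-cover)

    part-central : ∀ x v → Central (part x v)
    part-central x 𝟎 = Trisection.x₀-central (trisect x)
    part-central x ½ = central-∧ (Trisection.x₀ᶜ-central (trisect x)) (Trisection.x₂ᶜ-central (trisect x))
    part-central x 𝟏 = Trisection.x₂-central (trisect x)

    below : x ≈[ p ∧ q ] y → ((p ∧ x) ∧ q) ≤ y
    below x≈y = ≤-trans
      (∧-greatest (∧-mono (x∧y≤x _ _) ≤-refl) (≤-trans (x∧y≤x _ _) (x∧y≤y _ _))) (≈[]⇒≤ x≈y)

  module DeMorgan (∼ : Op₁ A) (∼-antitone : ∀ {x y} → x ≤ y → ∼ y ≤ ∼ x)
    (∼-involutive : ∀ x → ∼ (∼ x) ≈ x) where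

    ∼-swap : ∼ x ≤ y → ∼ y ≤ x
    ∼-swap ∼x≤y = ≤-trans (∼-antitone ∼x≤y) (≤-reflexive (∼-involutive _))

    ∼𝟘≈𝟙 : ∼ 𝟘 ≈ 𝟙
    ∼𝟘≈𝟙 = antisym (maximum _)
      (≤-trans (≤-reflexive (Eq.sym (∼-involutive _))) (∼-antitone (minimum _)))

    ∼𝟙≈𝟘 : ∼ 𝟙 ≈ 𝟘
    ∼𝟙≈𝟘 = antisym (∼-swap (maximum _)) (minimum _)

    ∼-∧-≤ : ∼ (x ∧ y) ≤ (∼ x ∨ ∼ y)
    ∼-∧-≤ = ∼-swap (∧-greatest (∼-swap (x≤x∨y _ _)) (∼-swap (y≤x∨y _ _)))

    ∼-∧ : ∼ (x ∧ y) ≈ (∼ x ∨ ∼ y)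
    ∼-∧ = antisym ∼-∧-≤ (∨-least (∼-antitone (x∧y≤x _ _)) (∼-antitone (x∧y≤y _ _)))

    ≤-swap : x ≤ ∼ y → y ≤ ∼ x
    ≤-swap x≤∼y = ≤-trans (≤-reflexive (Eq.sym (∼-involutive _))) (∼-antitone x≤∼y)

    ∼-∨-≥ : (∼ x ∧ ∼ y) ≤ ∼ (x ∨ y)
    ∼-∨-≥ = ≤-swap (∨-least (≤-swap (x∧y≤x _ _)) (≤-swap (x∧y≤y _ _)))

    Complemented : A → Set ℓ
    Complemented p = Complements p (∼ p)

    complemented-𝟙 : Complemented 𝟙
    complemented-𝟙 = ≤-trans (x∧y≤y _ _) (≤-reflexive ∼𝟙≈𝟘) , x≤x∨y _ _

    complemented-∼ : Complemented p → Complemented (∼ p)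
    complemented-∼ (p∧∼p≤0 , 1≤p∨∼p) = complements-sym
      ( ≤-trans (∧-mono (≤-reflexive (∼-involutive _)) ≤-refl) p∧∼p≤0
      , ≤-trans 1≤p∨∼p (∨-mono (≤-reflexive (Eq.sym (∼-involutive _))) ≤-refl))

    complemented-∧ : ∀ {p q} → Complemented p → Complemented q → Complemented (p ∧ q)
    complemented-∧ p q with complements-∧ p q
    ... | pq≤0 , 1≤pq = ≤-trans (∧-mono ≤-refl (≤-reflexive ∼-∧)) pq≤0 ,
                        ≤-trans 1≤pq (∨-mono ≤-refl (≤-reflexive (Eq.sym ∼-∧)))

    -- Negating non-contradiction yields excluded middle, and `covers⇒complemented` goes back.
    -- Łukasiewicz algebras supply the disjointness of ∇ x and its negation, Sugihara monoids the
    -- covering.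
    disjoint⇒complemented : (p ∧ ∼ p) ≤ 𝟘 → Complemented p
    disjoint⇒complemented {p} p∧∼p≤0 = p∧∼p≤0 , (begin
      𝟙               ≈⟨ ∼𝟘≈𝟙 ⟨
      ∼ 𝟘             ≤⟨ ∼-antitone p∧∼p≤0 ⟩
      ∼ (p ∧ ∼ p)     ≤⟨ ∼-∧-≤ ⟩
      (∼ p ∨ ∼ (∼ p)) ≤⟨ ∨-least (y≤x∨y _ _) (≤-trans (≤-reflexive (∼-involutive p)) (x≤x∨y _ _)) ⟩
      (p ∨ ∼ p)       ∎)

    covers⇒complemented : 𝟙 ≤ (p ∨ ∼ p) → Complemented p
    covers⇒complemented {p} 1≤p∨∼p = (begin
      (p ∧ ∼ p)       ≤⟨ ∧-greatest (x∧y≤y _ _) (≤-trans (x∧y≤x _ _) (≤-reflexive (Eq.sym (∼-involutive p)))) ⟩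
      (∼ p ∧ ∼ (∼ p)) ≤⟨ ∼-∨-≥ ⟩
      ∼ (p ∨ ∼ p)     ≤⟨ ∼-antitone 1≤p∨∼p ⟩
      ∼ 𝟙             ≈⟨ ∼𝟙≈𝟘 ⟩
      𝟘               ∎) , 1≤p∨∼p

    -- From p ∧ y ≤ x follows ∼ x ≤ ∼ p ∨ ∼ y, and meeting with p removes ∼ p.
    ∼-≈[] : Complemented p → x ≈[ p ] y → ∼ x ≈[ p ] ∼ y
    ∼-≈[] {p} (p∧∼p≤0 , _) x≈y = ≈[]-antisym (below (Eq.sym x≈y)) (below x≈y)
      where
      below : ∀ {x y} → y ≈[ p ] x → (p ∧ ∼ x) ≤ ∼ y
      below y≈x = ≤-trans
        (∧-mono ≤-refl (≤-trans (∼-antitone (≈[]⇒≤ y≈x)) ∼-∧-≤)) (resolve p∧∼p≤0)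

    constants-∼ : ∀ {c} → ∼ c ≈ c → ∀ u → ∼ (constants c u) ≈ constants c (∼₃ u)
    constants-∼ ∼c≈c 𝟎 = ∼𝟘≈𝟙
    constants-∼ ∼c≈c ½ = ∼c≈c
    constants-∼ ∼c≈c 𝟏 = ∼𝟙≈𝟘

-- Trisection in c3dp-algebras

module C3DPAlgebra {X : Setoid a ℓ} (𝐀 : Algebra C3DPSig X) (isC3DP : Member (C3DP a ℓ) 𝐀) where
  open Axioms.IsC3DPAlgebra isC3DP
  open Axioms.IsRegularDPAlgebra isRegularDPAlgebra
  open Axioms.IsDPAlgebra isDPAlgebra
  open BoundedDistributiveLattice isBoundedDistributiveLattice

  private
    variable
      p x y : A

    infixr 7 _∧_
    infixr 6 _∨_

    _∧_ _∨_ : Op₂ A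
    x ∧ y = interp 𝐀 meet (x ∷ y ∷ [])
    x ∨ y = interp 𝐀 join (x ∷ y ∷ [])

    ¬ D : Op₁ A
    ¬ x = interp 𝐀 pcomp (x ∷ [])
    D x = interp 𝐀 dpcomp (x ∷ [])

    𝟘 c 𝟙 : A
    𝟘 = interp 𝐀 bot []
    c = interp 𝐀 core []
    𝟙 = interp 𝐀 top []

  ≤𝟘⇒≈ : x ≤ 𝟘 → x ≈ 𝟘
  ≤𝟘⇒≈ x≤0 = antisym x≤0 (minimum _)

  𝟙≤⇒≈ : 𝟙 ≤ x → x ≈ 𝟙
  𝟙≤⇒≈ 1≤x = antisym (maximum _) 1≤x

  Central : A → Set _
  Central p = Σ A (Complements p)

  ¬-complements : ∀ x → Complements (¬ x) (¬ (¬ x))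
  ¬-complements x = ≤-reflexive (¬-disjoint (¬ x)) , ≤-reflexive (Eq.sym (¬-stone x))

  D-complements : ∀ x → Complements (D x) (D (D x))
  D-complements x = ≤-reflexive (D-stone x) , ≤-reflexive (Eq.sym (D-covers (D x)))

  ¬-≈[] : x ≈[ p ] y → ¬ x ≈[ p ] ¬ y
  ¬-≈[] {p = p} x≈y = ≈[]-antisym (below (Eq.sym x≈y)) (below x≈y)
    where
    below : ∀ {x y} → y ≈[ p ] x → p ∧ ¬ x ≤ ¬ y
    below {x} {y} y≈x = ¬-greatest y (p ∧ ¬ x) (≤𝟘⇒≈ (begin
      y ∧ p ∧ ¬ x ≤⟨ ∧-greatest (≤-trans (∧-greatest (≤-trans (x∧y≤y _ _) (x∧y≤x _ _)) (x∧y≤x _ _)) (≈[]⇒≤ y≈x))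
                               (≤-trans (x∧y≤y _ _) (x∧y≤y _ _)) ⟩
      x ∧ ¬ x     ≈⟨ ¬-disjoint x ⟩
      𝟘           ∎))

  -- `D` is characterised by covers, so p acts through its complement q: the cover x ∨ (q ∨ D y) is
  -- verified on q trivially and on p by replacing y with x in y ∨ D y.
  D-≈[] : Central p → x ≈[ p ] y → D x ≈[ p ] D y
  D-≈[] {p} (q , p∧q≤0 , 1≤p∨q) x≈y = ≈[]-antisym (below x≈y) (below (Eq.sym x≈y))
    where
    below : ∀ {x y} → x ≈[ p ] y → p ∧ D x ≤ D y
    below {x} {y} x≈y = ≤-trans (∧-mono ≤-refl (D-smallest x (q ∨ D y) (𝟙≤⇒≈
      (by-cases 1≤p∨q
        (by-cases (≤-reflexive (Eq.sym (D-covers y)))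
          (≤-trans (∧-mono (x∧y≤y _ _) ≤-refl) (≤-trans (≈[]⇒≤ (Eq.sym x≈y)) (x≤x∨y _ _)))
          (≤-trans (x∧y≤y _ _) (≤-trans (y≤x∨y _ _) (y≤x∨y _ _))))
        (≤-trans (x∧y≤y _ _) (≤-trans (x≤x∨y _ _) (y≤x∨y _ _))))))) (resolve p∧q≤0)

  -- The Stone identities make ¬ x and D x complemented; x is 𝟘 on ¬ x and 𝟙 on D (D x). Regularity
  -- pins the middle from both sides: at (x , c) it gives x ∧ D x ≤ c because ¬ c ≈ 𝟘, and at (c ,
  -- x) it gives c ≤ x ∨ ¬ x because D c ≈ 𝟙.
  trisect : ∀ x → Trisection Central c x
  trisect x = record
    { x₀-central  = _ , ¬-complements x
    ; x₀ᶜ-central = _ , complements-sym (¬-complements x)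
    ; x₂-central  = _ , complements-sym (D-complements x)
    ; x₂ᶜ-central = _ , D-complements x
    ; x₀-cover    = proj₂ (¬-complements x)
    ; x₂-cover    = proj₂ (complements-sym (D-complements x))
    ; on-x₀       = ≤-trans (∧-greatest (x∧y≤y _ _) (x∧y≤x _ _)) (≤-reflexive (¬-disjoint x))
    ; on-x₂       = D-smallest (D x) x (𝟙≤⇒≈
        (≤-trans (≤-reflexive (Eq.sym (D-covers x))) (∨-least (y≤x∨y _ _) (x≤x∨y _ _))))
    ; middle-≤    = begin
        (¬ (¬ x) ∧ D x) ∧ x ≤⟨ ∧-greatest (x∧y≤y _ _) (≤-trans (x∧y≤x _ _) (x∧y≤y _ _)) ⟩
        x ∧ D x             ≤⟨ regular x c ⟩
        c ∨ ¬ c             ≤⟨ ∨-least ≤-refl (≤-trans (≤-reflexive ¬c≈𝟘) (minimum c)) ⟩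
        c                   ∎
    ; middle-≥    = begin
        (¬ (¬ x) ∧ D x) ∧ c   ≤⟨ ∧-greatest (≤-trans (x∧y≤x _ _) (x∧y≤x _ _)) (≤-trans (x∧y≤y _ _) c≤x∨¬x) ⟩
        ¬ (¬ x) ∧ (x ∨ ¬ x)   ≤⟨ ∧-mono ≤-refl (∨-least (y≤x∨y _ _) (x≤x∨y _ _)) ⟩
        ¬ (¬ x) ∧ (¬ x ∨ x)   ≤⟨ resolve (proj₁ (complements-sym (¬-complements x))) ⟩
        x                     ∎
    }
    where
    c≤x∨¬x : c ≤ x ∨ ¬ x
    c≤x∨¬x = ≤-trans
      (∧-greatest ≤-refl (≤-trans (maximum c) (≤-reflexive (Eq.sym Dc≈𝟙)))) (regular c x)

  central-cong : Central p → ∀ f {xs ys} → Pointwise (λ x y → x ≈[ p ] y) xs ys →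
                 interp 𝐀 f xs ≈[ p ] interp 𝐀 f ys
  central-cong p meet   (x≈ ∷ y≈ ∷ []) = ∧-≈[] x≈ y≈
  central-cong p join   (x≈ ∷ y≈ ∷ []) = ∨-≈[] x≈ y≈
  central-cong p pcomp  (x≈ ∷ [])      = ¬-≈[] x≈
  central-cong p dpcomp (x≈ ∷ [])      = D-≈[] p x≈
  central-cong p bot    []             = Eq.refl
  central-cong p core   []             = Eq.refl
  central-cong p top    []             = Eq.refl

  constant-hom : ∀ f vs → interp 𝐀 f (map (constants c) vs) ≈ constants c (interp c3dp f vs)
  constant-hom meet   (u ∷ v ∷ []) = constants-∧ u v
  constant-hom join   (u ∷ v ∷ []) = constants-∨ u v
  constant-hom pcomp  (𝟎 ∷ [])     = 𝟙≤⇒≈ (¬-greatest 𝟘 𝟙 (≤𝟘⇒≈ (x∧y≤x _ _)))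
  constant-hom pcomp  (½ ∷ [])     = ¬c≈𝟘
  constant-hom pcomp  (𝟏 ∷ [])     =
    ≤𝟘⇒≈ (≤-trans (∧-greatest (maximum _) ≤-refl) (≤-reflexive (¬-disjoint 𝟙)))
  constant-hom dpcomp (𝟎 ∷ [])     =
    𝟙≤⇒≈ (≤-trans (≤-reflexive (Eq.sym (D-covers 𝟘))) (∨-least (minimum _) ≤-refl))
  constant-hom dpcomp (½ ∷ [])     = Dc≈𝟙
  constant-hom dpcomp (𝟏 ∷ [])     = ≤𝟘⇒≈ (D-smallest 𝟙 𝟘 (𝟙≤⇒≈ (x≤x∨y _ _)))
  constant-hom bot    []           = Eq.refl
  constant-hom core   []           = Eq.refl
  constant-hom top    []           = Eq.refl

  ⊨c3dp : 𝐀 ⊨Th c3dp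
  ⊨c3dp = LocallyThree.locallyThree⇒⊨Th
    (locallyThree 𝐀 c3dp c Central (_ , complements-𝟙)
      (λ { (_ , p) (_ , q) → _ , complements-∧ p q }) central-cong constant-hom trisect)

-- Trisection in centred three-valued Łukasiewicz algebras

module C3ŁAlgebra {X : Setoid a ℓ} (𝐀 : Algebra C3ŁSig X) (isC3Ł : Member (C3Ł a ℓ) 𝐀) where
  open Axioms.IsC3ŁAlgebra isC3Ł
  open Axioms.Is3ŁAlgebra is3ŁAlgebra
  open BoundedDistributiveLattice isBoundedDistributiveLattice

  private
    variable
      p x y : A

    infixr 7 _∧_
    infixr 6 _∨_

    _∧_ _∨_ : Op₂ A
    x ∧ y = interp 𝐀 meet (x ∷ y ∷ [])
    x ∨ y = interp 𝐀 join (x ∷ y ∷ [])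

    ∼ ∇ : Op₁ A
    ∼ x = interp 𝐀 inv (x ∷ [])
    ∇ x = interp 𝐀 poss (x ∷ [])

    𝟘 z 𝟙 : A
    𝟘 = interp 𝐀 bot []
    z = interp 𝐀 centre []
    𝟙 = interp 𝐀 top []

    ∼-cong : x ≈ y → ∼ x ≈ ∼ y
    ∼-cong x≈y = cong 𝐀 inv (x≈y ∷ [])

    ∇-cong : x ≈ y → ∇ x ≈ ∇ y
    ∇-cong x≈y = cong 𝐀 poss (x≈y ∷ [])

  ∼-antitone : x ≤ y → ∼ y ≤ ∼ x
  ∼-antitone {x} {y} x≤y = ≤-trans (y≤x∨y _ _)
    (≤-reflexive (Eq.sym (Eq.trans (∼-cong x≤y) (∼-deMorgan x y))))

  open DeMorgan ∼ ∼-antitone ∼-involutive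

  ∇𝟘≈𝟘 : ∇ 𝟘 ≈ 𝟘
  ∇𝟘≈𝟘 = antisym (begin
    ∇ 𝟘       ≤⟨ ∧-greatest (≤-trans (maximum _) (≤-reflexive (Eq.sym ∼𝟘≈𝟙))) ≤-refl ⟩
    ∼ 𝟘 ∧ ∇ 𝟘 ≈⟨ ∼∧∇ 𝟘 ⟨
    𝟘 ∧ ∼ 𝟘   ≤⟨ x∧y≤x _ _ ⟩
    𝟘         ∎) (minimum _)

  x≤∇x : ∀ x → x ≤ ∇ x
  x≤∇x x = by-cases (≤-reflexive (Eq.sym (∼∨∇ x)))
    (≤-trans (≤-reflexive (∼∧∇ x)) (x∧y≤y _ _)) (x∧y≤y _ _)

  x∧∼∇x≈𝟘 : ∀ x → x ∧ ∼ (∇ x) ≈ 𝟘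
  x∧∼∇x≈𝟘 x = antisym (begin
    x ∧ ∼ (∇ x) ≤⟨ ≤-swap (begin
      𝟙               ≈⟨ ∼∨∇ x ⟨
      ∼ x ∨ ∇ x       ≤⟨ ∨-mono ≤-refl (≤-reflexive (Eq.sym (∼-involutive _))) ⟩
      ∼ x ∨ ∼ (∼ (∇ x)) ≈⟨ ∼-∧ ⟨
      ∼ (x ∧ ∼ (∇ x)) ∎) ⟩
    ∼ 𝟙         ≈⟨ ∼𝟙≈𝟘 ⟩
    𝟘           ∎) (minimum _)

  -- ∼ (∇ x) is disjoint from x; since ∇ is increasing and preserves meets, the disjointness passes
  -- from x to ∇ x.
  ∇-complemented : ∀ x → Complemented (∇ x)
  ∇-complemented x = disjoint⇒complemented (begin
    ∇ x ∧ ∼ (∇ x)     ≤⟨ ∧-mono ≤-refl (x≤∇x _) ⟩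
    ∇ x ∧ ∇ (∼ (∇ x)) ≈⟨ ∇-∧ _ _ ⟨
    ∇ (x ∧ ∼ (∇ x))   ≈⟨ ∇-cong (x∧∼∇x≈𝟘 x) ⟩
    ∇ 𝟘               ≈⟨ ∇𝟘≈𝟘 ⟩
    𝟘                 ∎)

  𝟙≤∇z : 𝟙 ≤ ∇ z
  𝟙≤∇z = ≤-trans (≤-reflexive (Eq.sym (∼∨∇ z)))
    (∨-least (≤-trans (≤-reflexive ∼z≈z) (x≤∇x z)) ≤-refl)

  ∼x∧∇x≤x : ∀ x → ∼ x ∧ ∇ x ≤ x
  ∼x∧∇x≤x x = ≤-trans (≤-reflexive (Eq.sym (∼∧∇ x))) (x∧y≤x _ _)

  x∧∇∼x≤∼x : ∀ x → x ∧ ∇ (∼ x) ≤ ∼ x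
  x∧∇∼x≤∼x x = ≤-trans (∧-mono (≤-reflexive (Eq.sym (∼-involutive x))) ≤-refl) (∼x∧∇x≤x (∼ x))

  -- The axiom a ∧ ∼ a ≈ ∼ a ∧ ∇ a at a = x ∧ z, using ∇ z ≈ 𝟙.
  [∼x∨z]∧∇x≤x∧z : ∀ x → (∼ x ∨ z) ∧ ∇ x ≤ x ∧ z
  [∼x∨z]∧∇x≤x∧z x = begin
    (∼ x ∨ z) ∧ ∇ x             ≤⟨ ∧-mono (∨-mono ≤-refl (≤-reflexive (Eq.sym ∼z≈z)))
                                     (∧-greatest ≤-refl (≤-trans (maximum _) 𝟙≤∇z)) ⟩
    (∼ x ∨ ∼ z) ∧ (∇ x ∧ ∇ z)   ≤⟨ ∧-mono (≤-reflexive (Eq.sym (∼-deMorgan x z)))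
                                     (≤-reflexive (Eq.sym (∇-∧ x z))) ⟩
    ∼ (x ∧ z) ∧ ∇ (x ∧ z)       ≤⟨ ∼x∧∇x≤x (x ∧ z) ⟩
    x ∧ z                       ∎

  ∇-≈[] : x ≈[ p ] y → ∇ x ≈[ p ] ∇ y
  ∇-≈[] {p = p} x≈y = ≈[]-antisym (below x≈y) (below (Eq.sym x≈y))
    where
    below : ∀ {x y} → x ≈[ p ] y → p ∧ ∇ x ≤ ∇ y
    below {x} {y} x≈y = begin
      p ∧ ∇ x   ≤⟨ ∧-mono (x≤∇x p) ≤-refl ⟩
      ∇ p ∧ ∇ x ≈⟨ ∇-∧ p x ⟨
      ∇ (p ∧ x) ≈⟨ ∇-cong x≈y ⟩
      ∇ (p ∧ y) ≈⟨ ∇-∧ p y ⟩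
      ∇ p ∧ ∇ y ≤⟨ x∧y≤y _ _ ⟩
      ∇ y       ∎

  -- ∼ (∇ (∼ x)) is the necessity of x. In the middle both bounds pass through (∼ x ∨ z) ∧ ∇ x,
  -- which lies below x ∧ z: the centre is under it by its second joinand, and x because x ∧ ∇ (∼ x)
  -- ≤ ∼ x.
  trisect : ∀ x → Trisection Complemented z x
  trisect x = record
    { x₀-central  = complemented-∼ (∇-complemented x)
    ; x₀ᶜ-central = ∇-complemented x
    ; x₂-central  = complemented-∼ (∇-complemented (∼ x))
    ; x₂ᶜ-central = ∇-complemented (∼ x)
    ; x₀-cover    = proj₂ (complements-sym (∇-complemented x))
    ; x₂-cover    = proj₂ (complements-sym (∇-complemented (∼ x)))
    ; on-x₀       = ≤-trans (∧-greatest (x∧y≤y _ _) (x∧y≤x _ _)) (≤-reflexive (x∧∼∇x≈𝟘 x))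
    ; on-x₂       = ∼-swap (x≤∇x (∼ x))
    ; middle-≤    = begin
        (∇ x ∧ ∇ (∼ x)) ∧ x ≤⟨ ∧-greatest
          (≤-trans (∧-greatest (x∧y≤y _ _) (≤-trans (x∧y≤x _ _) (x∧y≤y _ _))) (≤-trans (x∧∇∼x≤∼x x) (x≤x∨y _ _)))
          (≤-trans (x∧y≤x _ _) (x∧y≤x _ _)) ⟩
        (∼ x ∨ z) ∧ ∇ x     ≤⟨ [∼x∨z]∧∇x≤x∧z x ⟩
        x ∧ z               ≤⟨ x∧y≤y _ _ ⟩
        z                   ∎
    ; middle-≥    = begin
        (∇ x ∧ ∇ (∼ x)) ∧ z ≤⟨ ∧-greatest (≤-trans (x∧y≤y _ _) (y≤x∨y _ _)) (≤-trans (x∧y≤x _ _) (x∧y≤x _ _)) ⟩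
        (∼ x ∨ z) ∧ ∇ x     ≤⟨ [∼x∨z]∧∇x≤x∧z x ⟩
        x ∧ z               ≤⟨ x∧y≤x _ _ ⟩
        x                   ∎
    }

  central-cong : Complemented p → ∀ f {xs ys} → Pointwise (λ x y → x ≈[ p ] y) xs ys →
                 interp 𝐀 f xs ≈[ p ] interp 𝐀 f ys
  central-cong p meet   (x≈ ∷ y≈ ∷ []) = ∧-≈[] x≈ y≈
  central-cong p join   (x≈ ∷ y≈ ∷ []) = ∨-≈[] x≈ y≈
  central-cong p inv    (x≈ ∷ [])      = ∼-≈[] p x≈
  central-cong p poss   (x≈ ∷ [])      = ∇-≈[] x≈
  central-cong p bot    []             = Eq.refl
  central-cong p centre []             = Eq.refl
  central-cong p top    []             = Eq.refl

  constant-hom : ∀ f vs → interp 𝐀 f (map (constants z) vs) ≈ constants z (interp c3ł f vs)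
  constant-hom meet   (u ∷ v ∷ []) = constants-∧ u v
  constant-hom join   (u ∷ v ∷ []) = constants-∨ u v
  constant-hom inv    (u ∷ [])     = constants-∼ ∼z≈z u
  constant-hom poss   (𝟎 ∷ [])     = ∇𝟘≈𝟘
  constant-hom poss   (½ ∷ [])     = antisym (maximum _) 𝟙≤∇z
  constant-hom poss   (𝟏 ∷ [])     = antisym (maximum _) (x≤∇x _)
  constant-hom bot    []           = Eq.refl
  constant-hom centre []           = Eq.refl
  constant-hom top    []           = Eq.refl

  ⊨c3ł : 𝐀 ⊨Th c3ł
  ⊨c3ł = LocallyThree.locallyThree⇒⊨Th
    (locallyThree 𝐀 c3ł z Complemented complemented-𝟙 complemented-∧ central-cong constant-hom trisect)

-- Trisection in bounded three-valued Sugihara monoids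

module B3SMonoid {X : Setoid a ℓ} (𝐀 : Algebra B3SMSig X) (isB3SM : Member (B3SM a ℓ) 𝐀) where
  open Axioms.IsB3SMonoid isB3SM
  open Axioms.IsBoundedOddSugiharaMonoid isBoundedOddSugiharaMonoid
    renaming (minimum to 𝟘-minimum; maximum to 𝟙-maximum)
  open Axioms.IsOddSugiharaMonoid isOddSugiharaMonoid
    renaming (isDistributiveLattice to isDistributive)
  open AlgebraStructures.IsCommutativeMonoid isCommutativeMonoid
    using () renaming (identityˡ to ·-identityˡ; identityʳ to ·-identityʳ; assoc to ·-assoc; comm to ·-comm)

  isBoundedDistributiveLattice : Axioms.IsBoundedDistributiveLattice X _ _ _ _
  isBoundedDistributiveLattice = record
    { isDistributiveLattice = isDistributive
    ; minimum               = 𝟘-minimum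
    ; maximum               = 𝟙-maximum
    }

  open BoundedDistributiveLattice isBoundedDistributiveLattice

  private
    variable
      p x y z w : A

    infixr 8 _·_
    infixr 7 _∧_
    infixr 6 _∨_

    _∧_ _∨_ _·_ : Op₂ A
    x ∧ y = interp 𝐀 meet (x ∷ y ∷ [])
    x ∨ y = interp 𝐀 join (x ∷ y ∷ [])
    x · y = interp 𝐀 mul (x ∷ y ∷ [])

    ∼ ∇ : Op₁ A
    ∼ x = interp 𝐀 inv (x ∷ [])

    𝟘 e 𝟙 : A
    𝟘 = interp 𝐀 bot []
    e = interp 𝐀 unit []
    𝟙 = interp 𝐀 top []

    -- On the three-element chain, multiplying by the top sends 𝟎 to 𝟎 and both other values to 𝟏,
    -- so this is the possibility operator.
    ∇ x = 𝟙 · x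

  ∼-antitone : x ≤ y → ∼ y ≤ ∼ x
  ∼-antitone {x} {y} x≤y = ≤-trans (≤-reflexive (Eq.sym (·-identityˡ (∼ y))))
    (∼-contraposition x y e (≤-trans (≤-reflexive (·-identityˡ x)) x≤y))

  open DeMorgan ∼ ∼-antitone ∼-involutive

  ·-congˡ : x ≈ y → z · x ≈ z · y
  ·-congˡ x≈y = cong 𝐀 mul (Eq.refl ∷ x≈y ∷ [])

  contrapositionʳ : z · ∼ w ≤ ∼ x → z · x ≤ w
  contrapositionʳ {z} {w} {x} zw≤x = begin
    z · x         ≈⟨ ·-congˡ (∼-involutive x) ⟨
    z · ∼ (∼ x)   ≤⟨ ∼-contraposition (∼ w) (∼ x) z zw≤x ⟩
    ∼ (∼ w)       ≈⟨ ∼-involutive w ⟩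
    w             ∎

  -- Contraposition works in both directions, so multiplication by z has the right adjoint sending w
  -- to ∼ (z · ∼ w). Compatibility with joins and monotonicity are consequences.
  ·-∨-least : z · x ≤ w → z · y ≤ w → z · (x ∨ y) ≤ w
  ·-∨-least zx≤w zy≤w = contrapositionʳ (≤-trans
    (∧-greatest (∼-contraposition _ _ _ zx≤w) (∼-contraposition _ _ _ zy≤w)) ∼-∨-≥)

  ·-monoʳ : x ≤ y → z · x ≤ z · y
  ·-monoʳ {x} {y} {z} x≤y = contrapositionʳ
    (≤-trans (∼-contraposition y (z · y) z ≤-refl) (∼-swap (≤-trans (≤-reflexive (∼-involutive x)) x≤y)))

  ·-monoˡ : x ≤ y → x · z ≤ y · z
  ·-monoˡ {x} {y} {z} x≤y = begin
    x · z ≈⟨ ·-comm x z ⟩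
    z · x ≤⟨ ·-monoʳ x≤y ⟩
    z · y ≈⟨ ·-comm z y ⟩
    y · z ∎

  ∇-idem-≤ : ∀ x → ∇ (∇ x) ≤ ∇ x
  ∇-idem-≤ x = ≤-trans (≤-reflexive (Eq.sym (·-assoc 𝟙 𝟙 x))) (·-monoˡ (maximum _))

  x≤∇x : ∀ x → x ≤ ∇ x
  x≤∇x x = ≤-trans (≤-reflexive (Eq.sym (·-identityˡ x))) (·-monoˡ (maximum e))

  -- Contraposition with multiplier 𝟙: elements closed under ∇ are also closed under negation.
  ∇-∼ : ∇ p ≤ p → ∇ (∼ p) ≤ ∼ p
  ∇-∼ = ∼-contraposition _ _ 𝟙

  e≤x∨∼∇x : ∀ x → e ≤ x ∨ ∼ (∇ x)
  e≤x∨∼∇x x = ≤-trans (three-valued x)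
    (∨-mono ≤-refl (≤-reflexive (cong 𝐀 inv (·-comm x 𝟙 ∷ []))))

  -- Multiply e ≤ x ∨ ∼ (∇ x) by 𝟙.
  ∇-complemented : ∀ x → Complemented (∇ x)
  ∇-complemented x = covers⇒complemented (begin
    𝟙                 ≈⟨ ·-identityʳ 𝟙 ⟨
    𝟙 · e             ≤⟨ ·-monoʳ (e≤x∨∼∇x x) ⟩
    𝟙 · (x ∨ ∼ (∇ x)) ≤⟨ ·-∨-least (x≤x∨y _ _) (≤-trans (∇-∼ (∇-idem-≤ x)) (y≤x∨y _ _)) ⟩
    ∇ x ∨ ∼ (∇ x)     ∎)

  -- `∇-closed` makes p absorb factors: z · p ≤ 𝟙 · p ≤ p for every z. By `∇-∼` the same holds for ∼
  -- p, which is how products are localised.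
  record Central (p : A) : Set ℓ where
    constructor central
    field
      complemented : Complemented p
      ∇-closed     : ∇ p ≤ p

  open Central

  central-𝟙 : Central 𝟙
  central-𝟙 = central complemented-𝟙 (maximum _)

  central-∧ : ∀ {p q} → Central p → Central q → Central (p ∧ q)
  central-∧ (central p ∇p≤p) (central q ∇q≤q) = central (complemented-∧ p q)
    (∧-greatest (≤-trans (·-monoʳ (x∧y≤x _ _)) ∇p≤p) (≤-trans (·-monoʳ (x∧y≤y _ _)) ∇q≤q))

  central-∼ : Central p → Central (∼ p)
  central-∼ (central p ∇p≤p) = central (complemented-∼ p) (∇-∼ ∇p≤p)

  central-∇ : ∀ x → Central (∇ x)
  central-∇ x = central (∇-complemented x) (∇-idem-≤ x)

  -- From x ≤ ∼ p ∨ y one gets z · x ≤ z · ∼ p ∨ z · y ≤ ∼ p ∨ z · y, and meeting with p removes ∼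
  -- p.
  ·-≈[]ʳ : Central p → x ≈[ p ] y → (z · x) ≈[ p ] (z · y)
  ·-≈[]ʳ {p} {z = z} c x≈y = ≈[]-antisym (below x≈y) (below (Eq.sym x≈y))
    where
    below : ∀ {x y} → x ≈[ p ] y → p ∧ z · x ≤ z · y
    below {x} {y} x≈y = begin
      p ∧ z · x           ≤⟨ ∧-mono ≤-refl (·-monoʳ (by-cases (proj₂ (complemented c))
                               (≤-trans (∧-greatest (x∧y≤y _ _) (x∧y≤x _ _)) (≤-trans (≈[]⇒≤ x≈y) (y≤x∨y _ _)))
                               (≤-trans (x∧y≤y _ _) (x≤x∨y _ _)))) ⟩
      p ∧ z · (∼ p ∨ y)   ≤⟨ ∧-mono ≤-refl (·-∨-least
                               (≤-trans (≤-trans (·-monoˡ (maximum z)) (∇-closed (central-∼ c))) (x≤x∨y _ _))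
                               (y≤x∨y _ _)) ⟩
      p ∧ (∼ p ∨ z · y)   ≤⟨ resolve (proj₁ (complemented c)) ⟩
      z · y               ∎

  ·-≈[] : Central p → x ≈[ p ] y → z ≈[ p ] w → (x · z) ≈[ p ] (y · w)
  ·-≈[] c x≈y z≈w =
    Eq.trans (·-≈[]ʳ c z≈w) (Eq.trans (≈⇒≈[] (·-comm _ _))
      (Eq.trans (·-≈[]ʳ c x≈y) (≈⇒≈[] (·-comm _ _))))

  middle-≥e : ∀ x → (∇ x ∧ ∇ (∼ x)) ∧ e ≤ x
  middle-≥e x = begin
    (∇ x ∧ ∇ (∼ x)) ∧ e   ≤⟨ ∧-mono (x∧y≤x _ _) (e≤x∨∼∇x x) ⟩
    ∇ x ∧ (x ∨ ∼ (∇ x))   ≤⟨ ∧-mono ≤-refl (∨-least (y≤x∨y _ _) (x≤x∨y _ _)) ⟩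
    ∇ x ∧ (∼ (∇ x) ∨ x)   ≤⟨ resolve (proj₁ (∇-complemented x)) ⟩
    x                     ∎

  middle-e≤∼ : ∀ x → (∇ x ∧ ∇ (∼ x)) ∧ e ≤ ∼ x
  middle-e≤∼ x = begin
    (∇ x ∧ ∇ (∼ x)) ∧ e           ≤⟨ ∧-mono (x∧y≤y _ _) (e≤x∨∼∇x (∼ x)) ⟩
    ∇ (∼ x) ∧ (∼ x ∨ ∼ (∇ (∼ x))) ≤⟨ ∧-mono ≤-refl (∨-least (y≤x∨y _ _) (x≤x∨y _ _)) ⟩
    ∇ (∼ x) ∧ (∼ (∇ (∼ x)) ∨ ∼ x) ≤⟨ resolve (proj₁ (∇-complemented (∼ x))) ⟩
    ∼ x                           ∎

  trisect : ∀ x → Trisection Central e x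
  trisect x = record
    { x₀-central  = central-∼ (central-∇ x)
    ; x₀ᶜ-central = central-∇ x
    ; x₂-central  = central-∼ (central-∇ (∼ x))
    ; x₂ᶜ-central = central-∇ (∼ x)
    ; x₀-cover    = proj₂ (complements-sym (∇-complemented x))
    ; x₂-cover    = proj₂ (complements-sym (∇-complemented (∼ x)))
    ; on-x₀       = ≤-trans (∧-greatest (≤-trans (x∧y≤y _ _) (x≤∇x x)) (x∧y≤x _ _))
                      (proj₁ (∇-complemented x))
    ; on-x₂       = ∼-swap (x≤∇x (∼ x))
    -- With m the middle part, m ∧ e ≤ ∼ x is contraposed to x ≤ ∼ m ∨ ∼ e; since ∼ e ≈ e, meeting
    -- with m leaves e.
    ; middle-≤    = ≤-trans
        (∧-mono ≤-refl (≤-trans (≤-swap (middle-e≤∼ x))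
          (≤-trans ∼-∧-≤ (∨-mono ≤-refl (≤-reflexive ∼e≈e)))))
        (resolve (proj₁ (complemented-∧ (∇-complemented x) (∇-complemented (∼ x)))))
    ; middle-≥    = middle-≥e x
    }

  𝟙·𝟘≤𝟘 : 𝟙 · 𝟘 ≤ 𝟘
  𝟙·𝟘≤𝟘 = begin
    𝟙 · 𝟘   ≤⟨ ·-monoʳ (minimum _) ⟩
    𝟙 · ∼ 𝟙 ≤⟨ ∇-∼ (maximum _) ⟩
    ∼ 𝟙     ≈⟨ ∼𝟙≈𝟘 ⟩
    𝟘       ∎

  constants-· : ∀ u v → constants e u · constants e v ≈ constants e (u ·₃ v)
  constants-· 𝟎 v = antisym
    (≤-trans (≤-reflexive (·-comm _ _)) (≤-trans (·-monoˡ (maximum _)) 𝟙·𝟘≤𝟘)) (minimum _)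
  constants-· ½ v = ·-identityˡ _
  constants-· 𝟏 𝟎 = antisym 𝟙·𝟘≤𝟘 (minimum _)
  constants-· 𝟏 ½ = ·-identityʳ 𝟙
  constants-· 𝟏 𝟏 = antisym (maximum _) (square-increasing 𝟙)

  central-cong : Central p → ∀ f {xs ys} → Pointwise (λ x y → x ≈[ p ] y) xs ys →
                 interp 𝐀 f xs ≈[ p ] interp 𝐀 f ys
  central-cong p meet (x≈ ∷ y≈ ∷ []) = ∧-≈[] x≈ y≈
  central-cong p join (x≈ ∷ y≈ ∷ []) = ∨-≈[] x≈ y≈
  central-cong p mul  (x≈ ∷ y≈ ∷ []) = ·-≈[] p x≈ y≈
  central-cong p inv  (x≈ ∷ [])      = ∼-≈[] (complemented p) x≈
  central-cong p bot  []             = Eq.refl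
  central-cong p unit []             = Eq.refl
  central-cong p top  []             = Eq.refl

  constant-hom : ∀ f vs → interp 𝐀 f (map (constants e) vs) ≈ constants e (interp b3sm f vs)
  constant-hom meet (u ∷ v ∷ []) = constants-∧ u v
  constant-hom join (u ∷ v ∷ []) = constants-∨ u v
  constant-hom mul  (u ∷ v ∷ []) = constants-· u v
  constant-hom inv  (u ∷ [])     = constants-∼ ∼e≈e u
  constant-hom bot  []           = Eq.refl
  constant-hom unit []           = Eq.refl
  constant-hom top  []           = Eq.refl

  ⊨b3sm : 𝐀 ⊨Th b3sm
  ⊨b3sm = LocallyThree.locallyThree⇒⊨Th
    (locallyThree 𝐀 b3sm e Central central-𝟙 central-∧ central-cong constant-hom trisect)

-- Arithmetic of centred three-valued MV-algebras

module C3MVArithmetic {X : Setoid a ℓ} (𝐀 : Algebra C3MVSig X) (isC3MV : Member (C3MV a ℓ) 𝐀) where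
  open Axioms.IsC3MVAlgebra isC3MV public

  open Setoid X public using (_≈_; sym; trans) renaming (Carrier to A; refl to ≈-refl)
  open SetoidReasoning X

  infixr 6 _⊕_

  _⊕_ : Op₂ A
  x ⊕ y = interp 𝐀 plus (x ∷ y ∷ [])

  ∼ : Op₁ A
  ∼ x = interp 𝐀 inv (x ∷ [])

  𝟘 c 𝟙 : A
  𝟘 = interp 𝐀 zero []
  c = interp 𝐀 centre []
  𝟙 = ∼ 𝟘

  commutativeMonoid : CommutativeMonoid a ℓ
  commutativeMonoid = record { isCommutativeMonoid = isCommutativeMonoid }

  open CommutativeMonoid commutativeMonoid public
    using (commutativeSemigroup; identityˡ; assoc; comm; ∙-congˡ; ∙-congʳ)
    renaming (∙-cong to ⊕-cong)
  open CommutativeSemigroupProperties commutativeSemigroup public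
    using (interchange; x∙yz≈y∙xz)

  private
    variable
      q r x y z w : A

  infix 4 _≤_

  _≤_ : A → A → Set ℓ
  x ≤ y = ∼ x ⊕ y ≈ 𝟙

  Idempotent : A → Set ℓ
  Idempotent q = q ⊕ q ≈ q

  ∼-cong : x ≈ y → ∼ x ≈ ∼ y
  ∼-cong x≈y = cong 𝐀 inv (x≈y ∷ [])

  𝟙-absorbingˡ : ∀ x → 𝟙 ⊕ x ≈ 𝟙
  𝟙-absorbingˡ x = trans (comm 𝟙 x) (∼𝟘-absorbing x)

  ∼𝟙⊕x≈x : ∀ x → ∼ 𝟙 ⊕ x ≈ x
  ∼𝟙⊕x≈x x = trans (∙-congʳ (∼-involutive 𝟘)) (identityˡ x)

  ∼x⊕x≈𝟙 : ∀ x → ∼ x ⊕ x ≈ 𝟙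
  ∼x⊕x≈𝟙 x = begin
    ∼ x ⊕ x               ≈⟨ ∙-congʳ (∼-cong (∼𝟙⊕x≈x x)) ⟨
    ∼ (∼ 𝟙 ⊕ x) ⊕ x       ≈⟨ łukasiewicz x 𝟙 ⟨
    ∼ (∼ x ⊕ 𝟙) ⊕ 𝟙       ≈⟨ ∼𝟘-absorbing _ ⟩
    𝟙                     ∎

  x⊕∼x≈𝟙 : ∀ x → x ⊕ ∼ x ≈ 𝟙
  x⊕∼x≈𝟙 x = trans (comm _ _) (∼x⊕x≈𝟙 x)

  -- ∼ (∼ x ⊕ y) ⊕ y is the MV join of x and y, and `łukasiewicz` says that it is commutative.
  -- Comparing its two forms when x ≤ y writes y as x plus a remainder, as `≤⇒⊕` records.
  ≤⇒∨≈ : x ≤ y → ∼ (∼ x ⊕ y) ⊕ y ≈ y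
  ≤⇒∨≈ {y = y} x≤y = trans (∙-congʳ (∼-cong x≤y)) (∼𝟙⊕x≈x y)

  ≤⇒⊕ : x ≤ y → y ≈ ∼ (∼ y ⊕ x) ⊕ x
  ≤⇒⊕ x≤y = trans (sym (≤⇒∨≈ x≤y)) (łukasiewicz _ _)

  ≤-antisym : x ≤ y → y ≤ x → x ≈ y
  ≤-antisym x≤y y≤x = trans (sym (≤⇒∨≈ y≤x)) (sym (≤⇒⊕ x≤y))

  double-idempotent : ∀ x → Idempotent (x ⊕ x)
  double-idempotent x = begin
    (x ⊕ x) ⊕ x ⊕ x ≈⟨ assoc x x (x ⊕ x) ⟩
    x ⊕ x ⊕ x ⊕ x   ≈⟨ ∙-congˡ (three-valued x) ⟩
    x ⊕ x ⊕ x       ≈⟨ three-valued x ⟩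
    x ⊕ x           ∎

  idempotent-⊕ : Idempotent q → Idempotent r → Idempotent (q ⊕ r)
  idempotent-⊕ {q} {r} qq rr = trans (interchange q r q r) (⊕-cong qq rr)

  -- The join of q and ∼ q can be read as ∼ (∼ q ⊕ ∼ q) ⊕ ∼ q or as ∼ (q ⊕ q) ⊕ q; for idempotent q
  -- the second is 𝟙, so ∼ q ⊕ ∼ q ≤ ∼ q.
  idempotent-∼ : Idempotent q → Idempotent (∼ q)
  idempotent-∼ {q} qq = ≤-antisym
    (begin
      ∼ (∼ q ⊕ ∼ q) ⊕ ∼ q   ≈⟨ łukasiewicz q (∼ q) ⟩
      ∼ (∼ (∼ q) ⊕ q) ⊕ q   ≈⟨ ∙-congʳ (∼-cong (trans (∙-congʳ (∼-involutive q)) qq)) ⟩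
      ∼ q ⊕ q               ≈⟨ ∼x⊕x≈𝟙 q ⟩
      𝟙                     ∎)
    (begin
      ∼ (∼ q) ⊕ ∼ q ⊕ ∼ q   ≈⟨ assoc _ _ _ ⟨
      (∼ (∼ q) ⊕ ∼ q) ⊕ ∼ q ≈⟨ ∙-congʳ (∼x⊕x≈𝟙 (∼ q)) ⟩
      𝟙 ⊕ ∼ q               ≈⟨ 𝟙-absorbingˡ _ ⟩
      𝟙                     ∎)

  -- If ∼ r ≤ w then w is a sum with summand ∼ r, hence absorbs ∼ r.
  cover-𝟙 : Idempotent (∼ r) → r ⊕ w ≈ 𝟙 → ∼ r ⊕ w ≈ 𝟙 → w ≈ 𝟙
  cover-𝟙 {r} {w} rr r⊕w ∼r⊕w = begin
    w                         ≈⟨ w≈ ⟩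
    u ⊕ ∼ r                   ≈⟨ ∙-congˡ rr ⟨
    u ⊕ ∼ r ⊕ ∼ r             ≈⟨ x∙yz≈y∙xz _ _ _ ⟩
    ∼ r ⊕ u ⊕ ∼ r             ≈⟨ ∙-congˡ w≈ ⟨
    ∼ r ⊕ w                   ≈⟨ ∼r⊕w ⟩
    𝟙                         ∎
    where
    u : A
    u = ∼ (∼ w ⊕ ∼ r)
    w≈ : w ≈ u ⊕ ∼ r
    w≈ = ≤⇒⊕ (trans (∙-congʳ (∼-involutive r)) r⊕w)

  -- Agreement off q, dual to the lattice case: enlarging q makes it coarser.
  infix 4 _≈[_]_

  _≈[_]_ : A → A → A → Set ℓ
  x ≈[ q ] y = q ⊕ x ≈ q ⊕ y

  -- Each of x ≤ y and y ≤ x says that one element equals 𝟙, so gluing an equation reduces to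
  -- `cover-𝟙`.
  glue₂ : Idempotent (∼ r) → x ≈[ r ] y → x ≈[ ∼ r ] y → x ≈ y
  glue₂ {r} {x} {y} rr x≈y x≈y′ = ≤-antisym
    (cover-𝟙 rr (below x≈y) (below x≈y′)) (cover-𝟙 rr (below (sym x≈y)) (below (sym x≈y′)))
    where
    below : ∀ {q x y} → x ≈[ q ] y → q ⊕ ∼ x ⊕ y ≈ 𝟙
    below {q} {x} {y} x≈y = begin
      q ⊕ ∼ x ⊕ y ≈⟨ x∙yz≈y∙xz _ _ _ ⟩
      ∼ x ⊕ q ⊕ y ≈⟨ ∙-congˡ x≈y ⟨
      ∼ x ⊕ q ⊕ x ≈⟨ x∙yz≈y∙xz _ _ _ ⟩
      q ⊕ ∼ x ⊕ x ≈⟨ ∙-congˡ (∼x⊕x≈𝟙 x) ⟩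
      q ⊕ 𝟙       ≈⟨ ∼𝟘-absorbing q ⟩
      𝟙           ∎

  ≈⇒≈[] : x ≈ y → x ≈[ q ] y
  ≈⇒≈[] = ∙-congˡ

  ≈[]-extend : x ≈[ q ] y → x ≈[ r ⊕ q ] y
  ≈[]-extend {x} {q} {y} {r} x≈y = trans (assoc r q x) (trans (∙-congˡ x≈y) (sym (assoc r q y)))

  ≈[]-comm : x ≈[ q ⊕ r ] y → x ≈[ r ⊕ q ] y
  ≈[]-comm x≈y = trans (∙-congʳ (comm _ _)) (trans x≈y (∙-congʳ (comm _ _)))

  ⊕-≈[] : x ≈[ q ] y → z ≈[ q ] w → (x ⊕ z) ≈[ q ] (y ⊕ w)
  ⊕-≈[] {x} {q} {y} {z} {w} x≈y z≈w = begin
    q ⊕ x ⊕ z   ≈⟨ assoc _ _ _ ⟨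
    (q ⊕ x) ⊕ z ≈⟨ ∙-congʳ x≈y ⟩
    (q ⊕ y) ⊕ z ≈⟨ assoc _ _ _ ⟩
    q ⊕ y ⊕ z   ≈⟨ x∙yz≈y∙xz _ _ _ ⟩
    y ⊕ q ⊕ z   ≈⟨ ∙-congˡ z≈w ⟩
    y ⊕ q ⊕ w   ≈⟨ x∙yz≈y∙xz _ _ _ ⟩
    q ⊕ y ⊕ w   ∎

  -- Off q, the negation of x depends on q ⊕ x alone, which makes ∼ compatible with agreement off q.
  -- Idempotence supplies a second copy of q: one copy turns ∼ (q ⊕ ∼ x) into a join that can be
  -- rewritten to expose x, the other meets that x in q ⊕ x.
  ∼-absorb : Idempotent q → ∀ x → q ⊕ ∼ x ≈ q ⊕ ∼ (q ⊕ x)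
  ∼-absorb {q} qq x = ≤-antisym
    (begin
      ∼ (q ⊕ ∼ x) ⊕ q ⊕ ∼ (q ⊕ x)                   ≈⟨ ∙-congˡ (∙-congʳ qq) ⟨
      ∼ (q ⊕ ∼ x) ⊕ (q ⊕ q) ⊕ ∼ (q ⊕ x)             ≈⟨ ∙-congˡ (assoc _ _ _) ⟩
      ∼ (q ⊕ ∼ x) ⊕ q ⊕ q ⊕ ∼ (q ⊕ x)               ≈⟨ assoc _ _ _ ⟨
      (∼ (q ⊕ ∼ x) ⊕ q) ⊕ q ⊕ ∼ (q ⊕ x)             ≈⟨ ∙-congʳ (trans (∙-congʳ (∼-cong (comm _ _))) (łukasiewicz x q)) ⟩
      (∼ (∼ q ⊕ x) ⊕ x) ⊕ q ⊕ ∼ (q ⊕ x)             ≈⟨ assoc _ _ _ ⟩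
      ∼ (∼ q ⊕ x) ⊕ x ⊕ q ⊕ ∼ (q ⊕ x)               ≈⟨ ∙-congˡ (trans (sym (assoc _ _ _)) (∙-congʳ (comm _ _))) ⟩
      ∼ (∼ q ⊕ x) ⊕ (q ⊕ x) ⊕ ∼ (q ⊕ x)             ≈⟨ ∙-congˡ (x⊕∼x≈𝟙 _) ⟩
      ∼ (∼ q ⊕ x) ⊕ 𝟙                               ≈⟨ ∼𝟘-absorbing _ ⟩
      𝟙                                             ∎)
    (begin
      ∼ (q ⊕ ∼ (q ⊕ x)) ⊕ q ⊕ ∼ x                   ≈⟨ assoc _ _ _ ⟨
      (∼ (q ⊕ ∼ (q ⊕ x)) ⊕ q) ⊕ ∼ x                 ≈⟨ ∙-congʳ (trans (∙-congʳ (∼-cong (comm _ _))) (sym (≤⇒⊕ q≤q⊕x))) ⟩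
      (q ⊕ x) ⊕ ∼ x                                 ≈⟨ assoc _ _ _ ⟩
      q ⊕ x ⊕ ∼ x                                   ≈⟨ ∙-congˡ (x⊕∼x≈𝟙 x) ⟩
      q ⊕ 𝟙                                         ≈⟨ ∼𝟘-absorbing q ⟩
      𝟙                                             ∎)
    where
    q≤q⊕x : q ≤ q ⊕ x
    q≤q⊕x = trans (sym (assoc _ _ _)) (trans (∙-congʳ (∼x⊕x≈𝟙 q)) (𝟙-absorbingˡ x))

  ∼-≈[] : Idempotent q → x ≈[ q ] y → ∼ x ≈[ q ] ∼ y
  ∼-≈[] {q} {x} {y} qq x≈y =
    trans (∼-absorb qq x) (trans (∙-congˡ (∼-cong x≈y)) (sym (∼-absorb qq y)))

  quotient-setoid : A → Setoid a ℓ
  quotient-setoid q = record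
    { _≈_           = λ x y → x ≈[ q ] y
    ; isEquivalence = record { refl = ≈-refl ; sym = sym ; trans = trans }
    }

  quotient-cong : Idempotent q → ∀ f {xs ys} → Pointwise (λ x y → x ≈[ q ] y) xs ys →
                  interp 𝐀 f xs ≈[ q ] interp 𝐀 f ys
  quotient-cong qq plus   (x≈ ∷ y≈ ∷ []) = ⊕-≈[] x≈ y≈
  quotient-cong qq inv    (x≈ ∷ [])      = ∼-≈[] qq x≈
  quotient-cong qq zero   []             = ≈-refl
  quotient-cong qq centre []             = ≈-refl

  -- The same operations under a coarser equality. Since the axioms are equations they persist, so
  -- theorems such as `middle⇒c` can be applied off q.
  quotient : Idempotent q → Algebra C3MVSig (quotient-setoid q)
  quotient qq = record { interp = interp 𝐀 ; cong = quotient-cong qq }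

  quotient-isC3MV : (qq : Idempotent q) → Member (C3MV a ℓ) (quotient qq)
  quotient-isC3MV {q} qq = record
    { isCommutativeMonoid = record
      { isMonoid = record
        { isSemigroup = record
          { isMagma = record
            { isEquivalence = Setoid.isEquivalence (quotient-setoid q)
            ; ∙-cong        = ⊕-≈[]
            }
          ; assoc = λ x y z → ≈⇒≈[] (assoc x y z)
          }
        ; identity = (λ x → ≈⇒≈[] (identityˡ x)) ,
                     (λ x → ≈⇒≈[] (trans (comm x 𝟘) (identityˡ x)))
        }
      ; comm = λ x y → ≈⇒≈[] (comm x y)
      }
    ; ∼-involutive  = λ x → ≈⇒≈[] (∼-involutive x)
    ; ∼𝟘-absorbing  = λ x → ≈⇒≈[] (∼𝟘-absorbing x)
    ; łukasiewicz   = λ x y → ≈⇒≈[] (łukasiewicz x y)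
    ; three-valued  = λ x → ≈⇒≈[] (three-valued x)
    ; ∼c≈c          = ≈⇒≈[] ∼c≈c
    }

  c⊕c≈𝟙 : c ⊕ c ≈ 𝟙
  c⊕c≈𝟙 = trans (∙-congʳ (sym ∼c≈c)) (∼x⊕x≈𝟙 c)

  -- With s = ∼ (x ⊕ c), both r = s ⊕ s and ∼ r cover x ⊕ c, so s ≈ 𝟘.
  fixpoint-unique : ∼ x ≈ x → x ≈ c
  fixpoint-unique {x} ∼x≈x = begin
    x     ≈⟨ identityˡ x ⟨
    𝟘 ⊕ x ≈⟨ ∙-congʳ s≈𝟘 ⟨
    -- As x and c are both fixed by ∼, `s` is the remainder in both forms of their join; once it
    -- vanishes, one form is x and the other is c.
    s ⊕ x ≈⟨ ∙-congʳ (∼-cong (trans (comm x c) (∙-congʳ (sym ∼c≈c)))) ⟩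
    ∼ (∼ c ⊕ x) ⊕ x ≈⟨ łukasiewicz x c ⟨
    ∼ (∼ x ⊕ c) ⊕ c ≈⟨ ∙-congʳ (∼-cong (∙-congʳ ∼x≈x)) ⟩
    s ⊕ c ≈⟨ ∙-congʳ s≈𝟘 ⟩
    𝟘 ⊕ c ≈⟨ identityˡ c ⟩
    c     ∎
    where
    s u v : A
    s = ∼ (x ⊕ c)
    u = ∼ (∼ x ⊕ s)
    v = ∼ (∼ c ⊕ s)

    s≤c : s ≤ c
    s≤c = begin
      ∼ s ⊕ c     ≈⟨ ∙-congʳ (∼-involutive _) ⟩
      (x ⊕ c) ⊕ c ≈⟨ assoc x c c ⟩
      x ⊕ c ⊕ c   ≈⟨ ∙-congˡ c⊕c≈𝟙 ⟩
      x ⊕ 𝟙       ≈⟨ ∼𝟘-absorbing x ⟩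
      𝟙           ∎

    s≤x : s ≤ x
    s≤x = begin
      ∼ s ⊕ x     ≈⟨ ∙-congʳ (trans (∼-involutive _) (comm x c)) ⟩
      (c ⊕ x) ⊕ x ≈⟨ assoc c x x ⟩
      c ⊕ x ⊕ x   ≈⟨ ∙-congˡ (trans (∙-congʳ (sym ∼x≈x)) (∼x⊕x≈𝟙 x)) ⟩
      c ⊕ 𝟙       ≈⟨ ∼𝟘-absorbing c ⟩
      𝟙           ∎

    x⊕c≈ : x ⊕ c ≈ (s ⊕ s) ⊕ (u ⊕ v)
    x⊕c≈ = begin
      x ⊕ c               ≈⟨ ⊕-cong (≤⇒⊕ s≤x) (≤⇒⊕ s≤c) ⟩
      (u ⊕ s) ⊕ (v ⊕ s)   ≈⟨ interchange u s v s ⟩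
      (u ⊕ v) ⊕ (s ⊕ s)   ≈⟨ comm _ _ ⟩
      (s ⊕ s) ⊕ (u ⊕ v)   ∎

    x⊕c≈𝟙 : x ⊕ c ≈ 𝟙
    x⊕c≈𝟙 = cover-𝟙 (idempotent-∼ (double-idempotent s))
      (begin
        (s ⊕ s) ⊕ x ⊕ c ≈⟨ assoc s s (x ⊕ c) ⟩
        s ⊕ s ⊕ x ⊕ c   ≈⟨ ∙-congˡ (∼x⊕x≈𝟙 (x ⊕ c)) ⟩
        s ⊕ 𝟙           ≈⟨ ∼𝟘-absorbing s ⟩
        𝟙               ∎)
      (begin
        ∼ (s ⊕ s) ⊕ x ⊕ c               ≈⟨ ∙-congˡ x⊕c≈ ⟩
        ∼ (s ⊕ s) ⊕ (s ⊕ s) ⊕ (u ⊕ v)   ≈⟨ assoc _ _ _ ⟨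
        (∼ (s ⊕ s) ⊕ (s ⊕ s)) ⊕ (u ⊕ v) ≈⟨ ∙-congʳ (∼x⊕x≈𝟙 (s ⊕ s)) ⟩
        𝟙 ⊕ (u ⊕ v)                     ≈⟨ 𝟙-absorbingˡ _ ⟩
        𝟙                               ∎)

    s≈𝟘 : s ≈ 𝟘
    s≈𝟘 = trans (∼-cong x⊕c≈𝟙) (∼-involutive 𝟘)

  -- The two hypotheses amount to ∼ x ≤ x and x ≤ ∼ x, which make x a fixpoint of ∼.
  middle⇒c : x ⊕ x ≈ 𝟙 → ∼ x ⊕ ∼ x ≈ 𝟙 → x ≈ c
  middle⇒c {x} 2x≈𝟙 2∼x≈𝟙 = fixpoint-unique
    (≤-antisym (trans (∙-congʳ (∼-involutive x)) 2x≈𝟙) 2∼x≈𝟙)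

-- Trisection in centred three-valued MV-algebras

module C3MVAlgebra {X : Setoid a ℓ} (𝐀 : Algebra C3MVSig X) (isC3MV : Member (C3MV a ℓ) 𝐀) where
  open C3MVArithmetic 𝐀 isC3MV

  constants : Three → A
  constants 𝟎 = 𝟘
  constants ½ = c
  constants 𝟏 = 𝟙

  -- Agreement is off q, so the part for v has to be 𝟘 where x has value v and 𝟙 elsewhere: x ⊕ x is
  -- 𝟘 exactly at value 𝟎, ∼ x ⊕ ∼ x exactly at 𝟏.
  part : A → Three → A
  part x 𝟎 = x ⊕ x
  part x ½ = ∼ (x ⊕ x) ⊕ ∼ (∼ x ⊕ ∼ x)
  part x 𝟏 = ∼ x ⊕ ∼ x

  part-idempotent : ∀ x v → Idempotent (part x v)
  part-idempotent x 𝟎 = double-idempotent x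
  part-idempotent x ½ = idempotent-⊕ (idempotent-∼ (double-idempotent x))
                                     (idempotent-∼ (double-idempotent (∼ x)))
  part-idempotent x 𝟏 = double-idempotent (∼ x)

  double-≈[]𝟘 : ∀ x → x ≈[ x ⊕ x ] 𝟘
  double-≈[]𝟘 x = begin
    (x ⊕ x) ⊕ x ≈⟨ assoc x x x ⟩
    x ⊕ x ⊕ x   ≈⟨ three-valued x ⟩
    x ⊕ x       ≈⟨ identityˡ _ ⟨
    𝟘 ⊕ x ⊕ x   ≈⟨ comm _ _ ⟩
    (x ⊕ x) ⊕ 𝟘 ∎
    where open SetoidReasoning X

  complement-≈[]𝟙 : ∀ q → q ≈[ ∼ q ] 𝟙
  complement-≈[]𝟙 q = trans (∼x⊕x≈𝟙 q) (sym (∼𝟘-absorbing (∼ q)))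

  part-constant : ∀ x v → x ≈[ part x v ] constants v
  part-constant x 𝟎 = double-≈[]𝟘 x
  -- Off the middle part both x ⊕ x and ∼ x ⊕ ∼ x become 𝟙, so uniqueness of the fixpoint applies in
  -- the quotient.
  part-constant x ½ = C3MVArithmetic.middle⇒c (quotient qq) (quotient-isC3MV qq)
    (≈[]-comm (≈[]-extend (complement-≈[]𝟙 (x ⊕ x))))
    (≈[]-extend (complement-≈[]𝟙 (∼ x ⊕ ∼ x)))
    where qq = part-idempotent x ½
  part-constant x 𝟏 = trans (≈⇒≈[] (sym (∼-involutive x)))
    (∼-≈[] (double-idempotent (∼ x)) (double-≈[]𝟘 (∼ x)))

  parts-glue : ∀ {x y} z → (∀ v → x ≈[ part z v ] y) → x ≈ y
  parts-glue z h = glue₂ (idempotent-∼ (double-idempotent z)) (h 𝟎)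
    (glue₂ (idempotent-∼ (double-idempotent (∼ z))) (⊕-≈[] ≈-refl (h 𝟏))
      (trans (sym (assoc _ _ _)) (trans (≈[]-comm (h ½)) (assoc _ _ _))))

  constants-⊕ : ∀ u v → constants u ⊕ constants v ≈ constants (u ⊕₃ v)
  constants-⊕ 𝟎 v = identityˡ _
  constants-⊕ ½ 𝟎 = trans (comm _ _) (identityˡ _)
  constants-⊕ ½ ½ = c⊕c≈𝟙
  constants-⊕ ½ 𝟏 = ∼𝟘-absorbing c
  constants-⊕ 𝟏 v = 𝟙-absorbingˡ _

  constants-∼ : ∀ u → ∼ (constants u) ≈ constants (∼₃ u)
  constants-∼ 𝟎 = ≈-refl
  constants-∼ ½ = ∼c≈c
  constants-∼ 𝟏 = ∼-involutive 𝟘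

  constant-hom : ∀ f vs → interp 𝐀 f (map constants vs) ≈ constants (interp c3mv f vs)
  constant-hom plus   (u ∷ v ∷ []) = constants-⊕ u v
  constant-hom inv    (u ∷ [])     = constants-∼ u
  constant-hom zero   []           = ≈-refl
  constant-hom centre []           = ≈-refl

  ⊨c3mv : 𝐀 ⊨Th c3mv
  ⊨c3mv = LocallyThree.locallyThree⇒⊨Th {i = a ⊔ ℓ} record
    { Locus            = Σ A Idempotent
    ; _≈[_]_           = λ x q y → x ≈[ proj₁ q ] y
    ; isEquivalence    = λ q → Setoid.isEquivalence (quotient-setoid (proj₁ q))
    ; congruence       = λ q → quotient-cong (proj₂ q)
    ; constant         = constants
    ; constant-hom     = λ q f vs → ≈⇒≈[] (constant-hom f vs)
    ; everywhere       = 𝟘 , identityˡ 𝟘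
    ; everywhere-sound = λ x≈y → trans (sym (identityˡ _)) (trans x≈y (identityˡ _))
    ; piece            = λ q z v → (proj₁ q ⊕ part z v) ,
                                   idempotent-⊕ (proj₂ q) (part-idempotent z v)
    ; restrict         = λ v x≈y → ≈[]-comm (≈[]-extend x≈y)
    ; piece-constant   = λ {q} {x} v → ≈[]-extend (part-constant x v)
    ; glue             = λ {q} {z} x≈y → parts-glue z λ v →
        trans (sym (assoc _ _ _)) (trans (≈[]-comm (x≈y v)) (assoc _ _ _))
    }

-- Mutual interpretations with the Łukasiewicz chain

private
  pattern v₀ = var zero
  pattern v₁ = var (suc zero)

c3dp⟶c3ł : c3dp ⟶ c3ł
c3dp⟶c3ł = record
  { translation = λ
    { meet   → app meet (v₀ ∷ v₁ ∷ [])
    ; join   → app join (v₀ ∷ v₁ ∷ [])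
    -- ¬ x contributes the value 𝟏 at 𝟎, and c ∧ D x the value ½ at ½; both vanish at 𝟏.
    ; inv    → app join (app pcomp (v₀ ∷ []) ∷
                         app meet (app core [] ∷ app dpcomp (v₀ ∷ []) ∷ []) ∷ [])
    ; poss   → app pcomp (app pcomp (v₀ ∷ []) ∷ [])
    ; bot    → app bot []
    ; centre → app core []
    ; top    → app top []
    }
  ; correct = λ
    { meet   (u ∷ v ∷ []) → refl
    ; join   (u ∷ v ∷ []) → refl
    ; inv    (𝟎 ∷ [])     → refl
    ; inv    (½ ∷ [])     → refl
    ; inv    (𝟏 ∷ [])     → refl
    ; poss   (𝟎 ∷ [])     → refl
    ; poss   (½ ∷ [])     → refl
    ; poss   (𝟏 ∷ [])     → refl
    ; bot    []           → refl
    ; centre []           → refl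
    ; top    []           → refl
    }
  }

c3ł⟶c3dp : c3ł ⟶ c3dp
c3ł⟶c3dp = record
  { translation = λ
    { meet   → app meet (v₀ ∷ v₁ ∷ [])
    ; join   → app join (v₀ ∷ v₁ ∷ [])
    ; pcomp  → app inv (app poss (v₀ ∷ []) ∷ [])
    ; dpcomp → app poss (app inv (v₀ ∷ []) ∷ [])
    ; bot    → app bot []
    ; core   → app centre []
    ; top    → app top []
    }
  ; correct = λ
    { meet   (u ∷ v ∷ []) → refl
    ; join   (u ∷ v ∷ []) → refl
    ; pcomp  (𝟎 ∷ [])     → refl
    ; pcomp  (½ ∷ [])     → refl
    ; pcomp  (𝟏 ∷ [])     → refl
    ; dpcomp (𝟎 ∷ [])     → refl
    ; dpcomp (½ ∷ [])     → refl
    ; dpcomp (𝟏 ∷ [])     → refl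
    ; bot    []           → refl
    ; core   []           → refl
    ; top    []           → refl
    }
  }

b3sm⟶c3ł : b3sm ⟶ c3ł
b3sm⟶c3ł = record
  { translation = λ
    { meet   → app meet (v₀ ∷ v₁ ∷ [])
    ; join   → app join (v₀ ∷ v₁ ∷ [])
    ; inv    → app inv (v₀ ∷ [])
    ; poss   → app mul (v₀ ∷ app top [] ∷ [])
    ; bot    → app bot []
    ; centre → app unit []
    ; top    → app top []
    }
  ; correct = λ
    { meet   (u ∷ v ∷ []) → refl
    ; join   (u ∷ v ∷ []) → refl
    ; inv    (u ∷ [])     → refl
    ; poss   (𝟎 ∷ [])     → refl
    ; poss   (½ ∷ [])     → refl
    ; poss   (𝟏 ∷ [])     → refl
    ; bot    []           → refl
    ; centre []           → refl
    ; top    []           → refl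
    }
  }

c3ł⟶b3sm : c3ł ⟶ b3sm
c3ł⟶b3sm = record
  { translation = λ
    { meet → app meet (v₀ ∷ v₁ ∷ [])
    ; join → app join (v₀ ∷ v₁ ∷ [])
    -- Each factor is kept where the other is nonzero, so the product is 𝟎 if a factor is 𝟎 and the
    -- join otherwise.
    ; mul  → app join (app meet (v₀ ∷ app poss (v₁ ∷ []) ∷ []) ∷
                       app meet (v₁ ∷ app poss (v₀ ∷ []) ∷ []) ∷ [])
    ; inv  → app inv (v₀ ∷ [])
    ; bot  → app bot []
    ; unit → app centre []
    ; top  → app top []
    }
  ; correct = λ
    { meet (u ∷ v ∷ []) → refl
    ; join (u ∷ v ∷ []) → refl
    ; mul  (𝟎 ∷ 𝟎 ∷ []) → refl
    ; mul  (𝟎 ∷ ½ ∷ []) → refl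
    ; mul  (𝟎 ∷ 𝟏 ∷ []) → refl
    ; mul  (½ ∷ 𝟎 ∷ []) → refl
    ; mul  (½ ∷ ½ ∷ []) → refl
    ; mul  (½ ∷ 𝟏 ∷ []) → refl
    ; mul  (𝟏 ∷ 𝟎 ∷ []) → refl
    ; mul  (𝟏 ∷ ½ ∷ []) → refl
    ; mul  (𝟏 ∷ 𝟏 ∷ []) → refl
    ; inv  (u ∷ [])     → refl
    ; bot  []           → refl
    ; unit []           → refl
    ; top  []           → refl
    }
  }

c3mv⟶c3ł : c3mv ⟶ c3ł
c3mv⟶c3ł = record
  { translation = λ
    { meet   → ∼ (∼ v₀ ∨ ∼ v₁)
    ; join   → v₀ ∨ v₁
    ; inv    → ∼ v₀
    ; poss   → v₀ ⊕ v₀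
    ; bot    → app zero []
    ; centre → app centre []
    ; top    → ∼ (app zero [])
    }
  ; correct = λ
    { meet   (𝟎 ∷ 𝟎 ∷ []) → refl
    ; meet   (𝟎 ∷ ½ ∷ []) → refl
    ; meet   (𝟎 ∷ 𝟏 ∷ []) → refl
    ; meet   (½ ∷ 𝟎 ∷ []) → refl
    ; meet   (½ ∷ ½ ∷ []) → refl
    ; meet   (½ ∷ 𝟏 ∷ []) → refl
    ; meet   (𝟏 ∷ 𝟎 ∷ []) → refl
    ; meet   (𝟏 ∷ ½ ∷ []) → refl
    ; meet   (𝟏 ∷ 𝟏 ∷ []) → refl
    ; join   (𝟎 ∷ 𝟎 ∷ []) → refl
    ; join   (𝟎 ∷ ½ ∷ []) → refl
    ; join   (𝟎 ∷ 𝟏 ∷ []) → refl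
    ; join   (½ ∷ 𝟎 ∷ []) → refl
    ; join   (½ ∷ ½ ∷ []) → refl
    ; join   (½ ∷ 𝟏 ∷ []) → refl
    ; join   (𝟏 ∷ 𝟎 ∷ []) → refl
    ; join   (𝟏 ∷ ½ ∷ []) → refl
    ; join   (𝟏 ∷ 𝟏 ∷ []) → refl
    ; inv    (u ∷ [])     → refl
    ; poss   (𝟎 ∷ [])     → refl
    ; poss   (½ ∷ [])     → refl
    ; poss   (𝟏 ∷ [])     → refl
    ; bot    []           → refl
    ; centre []           → refl
    ; top    []           → refl
    }
  }
  where
  ∼ : Term C3MVSig n → Term C3MVSig n
  ∼ s = app inv (s ∷ [])
  _⊕_ _∨_ : Term C3MVSig n → Term C3MVSig n → Term C3MVSig n
  s ⊕ t = app plus (s ∷ t ∷ [])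
  s ∨ t = ∼ (∼ s ⊕ t) ⊕ t

c3ł⟶c3mv : c3ł ⟶ c3mv
c3ł⟶c3mv = record
  { translation = λ
    -- Truncated addition differs from the join only at ½ ⊕ ½, which ∇ x ∧ ∇ y raises to 𝟏.
    { plus   → app join (app join (v₀ ∷ v₁ ∷ []) ∷
                         app meet (app poss (v₀ ∷ []) ∷ app poss (v₁ ∷ []) ∷ []) ∷ [])
    ; inv    → app inv (v₀ ∷ [])
    ; zero   → app bot []
    ; centre → app centre []
    }
  ; correct = λ
    { plus   (𝟎 ∷ 𝟎 ∷ []) → refl
    ; plus   (𝟎 ∷ ½ ∷ []) → refl
    ; plus   (𝟎 ∷ 𝟏 ∷ []) → refl
    ; plus   (½ ∷ 𝟎 ∷ []) → refl
    ; plus   (½ ∷ ½ ∷ []) → refl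
    ; plus   (½ ∷ 𝟏 ∷ []) → refl
    ; plus   (𝟏 ∷ v ∷ []) → refl
    ; inv    (u ∷ [])     → refl
    ; zero   []           → refl
    ; centre []           → refl
    }
  }

-- Axioms from three-valued identities

module C3ŁModel {X : Setoid a ℓ} (𝐀 : Algebra C3ŁSig X) (𝐀⊨ : 𝐀 ⊨Th c3ł) where
  open Laws 𝐀 c3ł 𝐀⊨
  open Setoid X using (isEquivalence)

  private
    infixr 7 _∧_
    infixr 6 _∨_

    _∧_ _∨_ : Term C3ŁSig n → Term C3ŁSig n → Term C3ŁSig n
    s ∧ t = app meet (s ∷ t ∷ [])
    s ∨ t = app join (s ∷ t ∷ [])

    ∼ ∇ : Term C3ŁSig n → Term C3ŁSig n
    ∼ s = app inv (s ∷ [])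
    ∇ s = app poss (s ∷ [])

    𝟘 z 𝟙 : Term C3ŁSig n
    𝟘 = app bot []
    z = app centre []
    𝟙 = app top []

  isBoundedDistributiveLattice : Axioms.IsBoundedDistributiveLattice X
    (λ x y → interp 𝐀 meet (x ∷ y ∷ [])) (λ x y → interp 𝐀 join (x ∷ y ∷ []))
    (interp 𝐀 bot []) (interp 𝐀 top [])
  isBoundedDistributiveLattice = record
    { isDistributiveLattice = BiasedLatticeStructures.isDistributiveLatticeʳʲᵐ record
      { isLattice = record
        { isEquivalence = isEquivalence
        ; ∨-comm        = law₂ (λ x y → x ∨ y ≑ y ∨ x)
        ; ∨-assoc       = law₃ (λ x y z → (x ∨ y) ∨ z ≑ x ∨ (y ∨ z))
        ; ∨-cong        = λ p q → cong 𝐀 join (p ∷ q ∷ [])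
        ; ∧-comm        = law₂ (λ x y → x ∧ y ≑ y ∧ x)
        ; ∧-assoc       = law₃ (λ x y z → (x ∧ y) ∧ z ≑ x ∧ (y ∧ z))
        ; ∧-cong        = λ p q → cong 𝐀 meet (p ∷ q ∷ [])
        ; absorptive    = law₂ (λ x y → x ∨ (x ∧ y) ≑ x) ,
                          law₂ (λ x y → x ∧ (x ∨ y) ≑ x)
        }
      ; ∨-distribʳ-∧ = law₃ (λ x y z → (y ∧ z) ∨ x ≑ (y ∨ x) ∧ (z ∨ x))
      }
    ; minimum = law₁ (λ x → 𝟘 ≑ 𝟘 ∧ x)
    ; maximum = law₁ (λ x → x ≑ x ∧ 𝟙)
    }

  isC3Ł : Member (C3Ł a ℓ) 𝐀
  isC3Ł = record
    { is3ŁAlgebra = record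
      { isBoundedDistributiveLattice = isBoundedDistributiveLattice
      ; ∼-involutive = law₁ (λ x → ∼ (∼ x) ≑ x)
      ; ∼-deMorgan   = law₂ (λ x y → ∼ (x ∧ y) ≑ ∼ x ∨ ∼ y)
      ; ∼∨∇          = law₁ (λ x → ∼ x ∨ ∇ x ≑ 𝟙)
      ; ∼∧∇          = law₁ (λ x → x ∧ ∼ x ≑ ∼ x ∧ ∇ x)
      ; ∇-∧          = law₂ (λ x y → ∇ (x ∧ y) ≑ ∇ x ∧ ∇ y)
      }
    ; ∼z≈z = law (∼ z ≑ z) []
    }

module C3DPModel {X : Setoid a ℓ} (𝐀 : Algebra C3DPSig X) (𝐀⊨ : 𝐀 ⊨Th c3dp) where
  open Laws 𝐀 c3dp 𝐀⊨
  open Setoid X using (_≈_; sym; trans) renaming (refl to ≈-refl)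

  private
    infixr 7 _∧_
    infixr 6 _∨_

    _∧_ _∨_ : Term C3DPSig n → Term C3DPSig n → Term C3DPSig n
    s ∧ t = app meet (s ∷ t ∷ [])
    s ∨ t = app join (s ∷ t ∷ [])

    ¬ D : Term C3DPSig n → Term C3DPSig n
    ¬ s = app pcomp (s ∷ [])
    D s = app dpcomp (s ∷ [])

    𝟘 c 𝟙 : Term C3DPSig n
    𝟘 = app bot []
    c = app core []
    𝟙 = app top []

  isC3DP : Member (C3DP a ℓ) 𝐀
  isC3DP = record
    { isRegularDPAlgebra = record
      { isDPAlgebra = record
        -- The interpretation sends `meet`, `join`, `bot` and `top` to themselves, so the lattice
        -- operations of the derived algebra compute to those of 𝐀.
        { isBoundedDistributiveLattice = C3ŁModel.isBoundedDistributiveLattice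
            (derived (translation c3dp⟶c3ł) 𝐀) (⊨Th-derived c3dp⟶c3ł 𝐀 𝐀⊨)
        ; ¬-disjoint = law₁ (λ x → x ∧ ¬ x ≑ 𝟘)
        -- A quasi-identity: the premise is used to replace ¬ 𝟘, which is 𝟙, by ¬ (x ∧ y), after
        -- which an identity finishes.
        ; ¬-greatest = λ x y x∧y≈𝟘 →
            trans (law₁ (λ y → y ≑ y ∧ ¬ 𝟘) y)
              (trans (cong 𝐀 meet (≈-refl ∷ cong 𝐀 pcomp (sym x∧y≈𝟘 ∷ []) ∷ []))
                (law₂ (λ x y → y ∧ ¬ (x ∧ y) ≑ y ∧ ¬ x) x y))
        ; D-covers   = law₁ (λ x → x ∨ D x ≑ 𝟙)
        -- The factor D (D (x ∨ y)) encodes the premise: D x ∧ D (D (x ∨ y)) ≤ y is an identity, and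
        -- when x ∨ y ≈ 𝟙 the factor is D (D 𝟙), which leaves D x unchanged.
        ; D-smallest = λ x y x∨y≈𝟙 →
            let D∧DD≈D : interp 𝐀 meet _ ≈ interp 𝐀 dpcomp (x ∷ [])
                D∧DD≈D = trans
                  (cong 𝐀 meet (≈-refl ∷ cong 𝐀 dpcomp (cong 𝐀 dpcomp (x∨y≈𝟙 ∷ []) ∷ []) ∷ []))
                  (law₁ (λ x → D x ∧ D (D 𝟙) ≑ D x) x)
            in trans (sym D∧DD≈D)
                 (trans (law₂ (λ x y → D x ∧ D (D (x ∨ y)) ≑ (D x ∧ D (D (x ∨ y))) ∧ y) x y)
                   (cong 𝐀 meet (D∧DD≈D ∷ ≈-refl ∷ [])))
        }
      ; regular = law₂ (λ x y → x ∧ D x ≑ (x ∧ D x) ∧ (y ∨ ¬ y))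
      }
    ; ¬-stone = law₁ (λ x → ¬ x ∨ ¬ (¬ x) ≑ 𝟙)
    ; D-stone = law₁ (λ x → D x ∧ D (D x) ≑ 𝟘)
    ; ¬c≈𝟘    = law (¬ c ≑ 𝟘) []
    ; Dc≈𝟙    = law (D c ≑ 𝟙) []
    }

module B3SMModel {X : Setoid a ℓ} (𝐀 : Algebra B3SMSig X) (𝐀⊨ : 𝐀 ⊨Th b3sm) where
  open Laws 𝐀 b3sm 𝐀⊨
  open Setoid X using (isEquivalence; sym; trans) renaming (refl to ≈-refl)
  open Axioms.IsBoundedDistributiveLattice
    (C3ŁModel.isBoundedDistributiveLattice
      (derived (translation b3sm⟶c3ł) 𝐀) (⊨Th-derived b3sm⟶c3ł 𝐀 𝐀⊨))

  private
    infixr 8 _·_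
    infixr 7 _∧_
    infixr 6 _∨_

    _∧_ _∨_ _·_ : Term B3SMSig n → Term B3SMSig n → Term B3SMSig n
    s ∧ t = app meet (s ∷ t ∷ [])
    s ∨ t = app join (s ∷ t ∷ [])
    s · t = app mul (s ∷ t ∷ [])

    ∼ : Term B3SMSig n → Term B3SMSig n
    ∼ s = app inv (s ∷ [])

    e 𝟙 : Term B3SMSig n
    e = app unit []
    𝟙 = app top []

  isB3SM : Member (B3SM a ℓ) 𝐀
  isB3SM = record
    { isBoundedOddSugiharaMonoid = record
      { isOddSugiharaMonoid = record
        { isDistributiveLattice = isDistributiveLattice
        ; isCommutativeMonoid   = BiasedStructures.isCommutativeMonoidˡ record
          { isSemigroup = record
            { isMagma = record
              { isEquivalence = isEquivalence
              ; ∙-cong        = λ p q → cong 𝐀 mul (p ∷ q ∷ [])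
              }
            ; assoc = law₃ (λ x y z → (x · y) · z ≑ x · (y · z))
            }
          ; identityˡ = law₁ (λ x → e · x ≑ x)
          ; comm      = law₂ (λ x y → x · y ≑ y · x)
          }
        ; square-increasing = law₁ (λ x → x ≑ x ∧ x · x)
        ; ∼-involutive      = law₁ (λ x → ∼ (∼ x) ≑ x)
        -- The premise says y ≈ y ∨ z · x; substituting the right-hand side for y turns the
        -- conclusion into an identity.
        ; ∼-contraposition  = λ x y z zx≤y →
            let y≈y∨zx = trans (law₂ (λ y w → y ≑ y ∨ (w ∧ y)) y (interp 𝐀 mul (z ∷ x ∷ [])))
                           (cong 𝐀 join (≈-refl ∷ sym zx≤y ∷ []))
                z·∼y≈ = cong 𝐀 mul (≈-refl ∷ cong 𝐀 inv (y≈y∨zx ∷ []) ∷ [])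
            in trans z·∼y≈
                 (trans (law₃ (λ x y z → z · ∼ (y ∨ z · x) ≑ z · ∼ (y ∨ z · x) ∧ ∼ x) x y z)
                   (cong 𝐀 meet (sym z·∼y≈ ∷ ≈-refl ∷ [])))
        ; ∼e≈e = law (∼ e ≑ e) []
        }
      ; minimum = minimum
      ; maximum = maximum
      }
    ; three-valued = law₁ (λ x → e ≑ e ∧ (x ∨ ∼ (x · 𝟙)))
    }

module C3MVModel {X : Setoid a ℓ} (𝐀 : Algebra C3MVSig X) (𝐀⊨ : 𝐀 ⊨Th c3mv) where
  open Laws 𝐀 c3mv 𝐀⊨
  open Setoid X using (isEquivalence)

  private
    infixr 6 _⊕_

    _⊕_ : Term C3MVSig n → Term C3MVSig n → Term C3MVSig n
    s ⊕ t = app plus (s ∷ t ∷ [])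

    ∼ : Term C3MVSig n → Term C3MVSig n
    ∼ s = app inv (s ∷ [])

    𝟘 c : Term C3MVSig n
    𝟘 = app zero []
    c = app centre []

  isC3MV : Member (C3MV a ℓ) 𝐀
  isC3MV = record
    { isCommutativeMonoid = BiasedStructures.isCommutativeMonoidˡ record
      { isSemigroup = record
        { isMagma = record
          { isEquivalence = isEquivalence
          ; ∙-cong        = λ p q → cong 𝐀 plus (p ∷ q ∷ [])
          }
        ; assoc = law₃ (λ x y z → (x ⊕ y) ⊕ z ≑ x ⊕ (y ⊕ z))
        }
      ; identityˡ = law₁ (λ x → 𝟘 ⊕ x ≑ x)
      ; comm      = law₂ (λ x y → x ⊕ y ≑ y ⊕ x)
      }
    ; ∼-involutive = law₁ (λ x → ∼ (∼ x) ≑ x)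
    ; ∼𝟘-absorbing = law₁ (λ x → x ⊕ ∼ 𝟘 ≑ ∼ 𝟘)
    ; łukasiewicz  = law₂ (λ x y → ∼ (∼ x ⊕ y) ⊕ y ≑ ∼ (∼ y ⊕ x) ⊕ x)
    ; three-valued = law₁ (λ x → x ⊕ (x ⊕ x) ≑ x ⊕ x)
    ; ∼c≈c         = law (∼ c ≑ c) []
    }

-- The four classes and their pairwise equivalence

C3DP-determined : DeterminedBy (C3DP a ℓ) c3dp
C3DP-determined = record { Member⇒⊨Th = C3DPAlgebra.⊨c3dp ; ⊨Th⇒Member = C3DPModel.isC3DP }

B3SM-determined : DeterminedBy (B3SM a ℓ) b3sm
B3SM-determined = record { Member⇒⊨Th = B3SMonoid.⊨b3sm ; ⊨Th⇒Member = B3SMModel.isB3SM }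

C3Ł-determined : DeterminedBy (C3Ł a ℓ) c3ł
C3Ł-determined = record { Member⇒⊨Th = C3ŁAlgebra.⊨c3ł ; ⊨Th⇒Member = C3ŁModel.isC3Ł }

C3MV-determined : DeterminedBy (C3MV a ℓ) c3mv
C3MV-determined = record { Member⇒⊨Th = C3MVAlgebra.⊨c3mv ; ⊨Th⇒Member = C3MVModel.isC3MV }

theorem5p10 : (a ℓ : Level) →
    AllPairs TermEquivalent (C3DP a ℓ ∷ B3SM a ℓ ∷ C3Ł a ℓ ∷ C3MV a ℓ ∷ [])
theorem5p10 a ℓ =
  ( termEquivalent C3DP-determined B3SM-determined
      (c3dp⟶c3ł ⟫ c3ł⟶b3sm) (b3sm⟶c3ł ⟫ c3ł⟶c3dp)
  ∷ termEquivalent C3DP-determined C3Ł-determined c3dp⟶c3ł c3ł⟶c3dp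
  ∷ termEquivalent C3DP-determined C3MV-determined
      (c3dp⟶c3ł ⟫ c3ł⟶c3mv) (c3mv⟶c3ł ⟫ c3ł⟶c3dp)
  ∷ [])
  ∷ ( termEquivalent B3SM-determined C3Ł-determined b3sm⟶c3ł c3ł⟶b3sm
    ∷ termEquivalent B3SM-determined C3MV-determined
        (b3sm⟶c3ł ⟫ c3ł⟶c3mv) (c3mv⟶c3ł ⟫ c3ł⟶b3sm)
    ∷ [])
  ∷ ( termEquivalent C3Ł-determined C3MV-determined c3ł⟶c3mv c3mv⟶c3ł ∷ [])
  ∷ []
  ∷ []
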